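{- Let $\mathcal D=(\mathcal P,\mathcal B)$ be a resolvable $2$-$(v,t,1)$-design with resolution $\{\mathcal B_1,\dots,\mathcal B_\ell\}$. Let $H$ be the graph with vertex set $\mathcal B$ in which two distinct blocks $B_1,B_2$ are adjacent if and only if $B_1\cap B_2\neq\emptyset$ or there exists $i$ with $B_1,B_2\in\mathcal B_i$. Then $H$ is regular with valency $\frac{v-t}{t-1}\left(t+\frac{t-1}{t}\right)$ and co-edge-regular of level $2$ with parameter $t(t+2)$. Moreover, the spectrum of $H$ is $$\left\{\left[\tfrac{v-t}{t-1}\left(t+\tfrac{t-1}{t}\right)\right]^1,\ \left[\tfrac{v-t}{t}-t\right]^{f_1},\ \left[\tfrac{v-1}{t-1}-t-2\right]^{f_2},\ [-t-1]^{f_3}\right\},$$ where $f_1=\frac{v-t}{t-1}$, $f_2=v-1$, and $f_3=\frac{v-1}{t}\left(\frac{v-t}{t-1}-t\right)$ (superscripts are multiplicities).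
   Context: A $2$-$(v,t,1)$-design is a pair $(\mathcal P,\mathcal B)$ with $|\mathcal P|=v$, where $\mathcal B$ is a collection of $t$-subsets (blocks) of $\mathcal P$ such that every pair of distinct points lies in exactly one block. It is resolvable if $\mathcal B$ can be partitioned into parts $\mathcal B_1,\dots,\mathcal B_\ell$ such that each $\mathcal B_i$ is a partition of $\mathcal P$; such a partition of $\mathcal B$ is called a resolution. Graphs are finite and simple; spectrum means adjacency spectrum. For adjacent vertices $x,y$, $\lambda(x,y)$ is the number of common neighbours. A regular graph is co-edge-regular with parameter $\mu$ if any two distinct non-adjacent vertices have exactly $\mu$ common neighbours; it has level $m$ if $\#\{\lambda(x,y)\mid x,y\text{ adjacent}\}=m$.
   Formalization: Assumes 2 ≤ t < v (for v = t there is one block and f₃ is negative; t = 1 makes the fractions undefined), and claims level 2 only for v ≠ t², since for v = t² (e.g. v = 4, t = 2) the graph H is complete and has level 1. -}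

module Defs where

open import Algebra.Bundles using (CommutativeRing)
import Algebra.Properties.Semiring.Sum as SemiringSum
open import Data.Bool.Base using (if_then_else_)
open import Data.Fin.Base using (Fin)
import Data.Fin.Properties as Fin
open import Data.Fin.Subset using (Subset; _∈_; _∩_; ∣_∣; Nonempty)
open import Data.Fin.Subset.Properties using (_∈?_; nonempty?; ∩-comm)
open import Data.Integer.Base using (+_)
open import Data.List.Base using (List; length; filter; replicate)
open import Data.List.Membership.Propositional using () renaming (_∈_ to _∈ˡ_)
open import Data.List.Relation.Unary.Unique.Propositional using (Unique)
open import Data.Nat.Base using (ℕ)
open import Data.Product using (∃; ∃₂; ∃!; _×_; _,_; swap; proj₁)
open import Data.Rational.Base using (ℚ; 0ℚ; 1ℚ; _*_; _/_)
open import Data.Rational.Properties using (_≟_; +-*-commutativeRing)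
open import Data.Sum.Base using (_⊎_)
import Data.Sum.Base as Sum
open import Data.Unit.Base using (⊤)
open import Data.Vec.Base using (tabulate)
open import Data.Vec.Functional using (Vector)
open import Function.Base using (const)
open import Function.Bundles using (_⇔_)
open import Level using (0ℓ)
open import Relation.Binary.Core using (Rel)
open import Relation.Binary.Definitions using (Symmetric; Irreflexive; Decidable)
open import Relation.Binary.PropositionalEquality using (_≡_; _≢_; _≗_; sym; subst)
open import Relation.Nullary using (¬_; does; ¬?)
open import Relation.Nullary.Decidable using (_×-dec_; _⊎-dec_)

open SemiringSum (CommutativeRing.semiring +-*-commutativeRing) using (sum)

------------------------------------------------------------------------
-- Designs

-- The members F i of a family, restricted to the indices satisfying Q, are
-- the parts of a partition of Fin n.
record IsPartition {n : ℕ} {I : Set} (Q : I → Set) (F : I → Subset n) : Set where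
  field
    nonempty   : ∀ i → Q i → Nonempty (F i)
    exactlyOne : ∀ x → ∃! _≡_ λ i → Q i × x ∈ F i

-- A 2-(v,t,1)-design on the point set Fin v.  The set of blocks is enumerated
-- without repetition by Fin b.
record Design (v t : ℕ) : Set where
  field
    b         : ℕ
    block     : Fin b → Subset v
    distinct  : ∀ {j k} → block j ≡ block k → j ≡ k
    blockSize : ∀ j → ∣ block j ∣ ≡ t
    balanced  : ∀ {x y} → x ≢ y → ∃! _≡_ λ j → x ∈ block j × y ∈ block j

-- part i is the set of (indices of) blocks in the i-th part of the resolution.
record Resolution {v t : ℕ} (D : Design v t) : Set where
  open Design D
  field
    ℓ               : ℕ
    part            : Fin ℓ → Subset b
    blocksPartition : IsPartition (const ⊤) part
    pointsPartition : ∀ i → IsPartition (_∈ part i) block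

------------------------------------------------------------------------
-- Graphs

record Graph (n : ℕ) : Set₁ where
  infix 4 _~_ _~?_
  field
    _~_    : Rel (Fin n) 0ℓ
    ~-sym  : Symmetric _~_
    ~-irr  : Irreflexive _≡_ _~_
    _~?_   : Decidable _~_

  neighbours : Fin n → Subset n
  neighbours x = tabulate λ y → does (x ~? y)

  commonNeighbours : Fin n → Fin n → ℕ
  commonNeighbours x y = ∣ neighbours x ∩ neighbours y ∣

  IsRegular : ℕ → Set
  IsRegular k = ∀ x → ∣ neighbours x ∣ ≡ k

  IsCoEdgeRegular : ℕ → Set
  IsCoEdgeRegular μ = ∀ x y → x ≢ y → ¬ (x ~ y) → commonNeighbours x y ≡ μ

  HasLevel : ℕ → Set
  HasLevel m = ∃ λ (values : List ℕ) → Unique values × length values ≡ m ×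
    (∀ a → a ∈ˡ values ⇔ ∃₂ λ x y → x ~ y × commonNeighbours x y ≡ a)

  adjacency : Fin n → Fin n → ℚ
  adjacency x y = if does (x ~? y) then 1ℚ else 0ℚ

blockGraph : ∀ {v t} (D : Design v t) → Resolution D → Graph (Design.b D)
blockGraph D R = record
  { _~_   = λ j k → j ≢ k × (Nonempty (block j ∩ block k) ⊎ ∃ λ i → j ∈ part i × k ∈ part i)
  ; ~-sym = λ { {j} {k} (j≢k , adj) → (λ k≡j → j≢k (sym k≡j)) ,
              Sum.map (subst Nonempty (∩-comm (block j) (block k))) (λ { (i , p) → i , swap p }) adj }
  ; ~-irr = λ j≡k adj → proj₁ adj j≡k
  ; _~?_  = λ j k → ¬? (j Fin.≟ k) ×-dec
              (nonempty? (block j ∩ block k) ⊎-dec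
               Fin.any? (λ i → (j ∈? part i) ×-dec (k ∈? part i)))
  }
  where
  open Design D
  open Resolution R

------------------------------------------------------------------------
-- Spectra

Matrix : ℕ → Set
Matrix n = Fin n → Fin n → ℚ

linearCombination : ∀ {m n} → Vector ℚ m → (Fin m → Vector ℚ n) → Vector ℚ n
linearCombination c u x = sum λ k → c k * u k x

record IsBasis {m n : ℕ} (W : Vector ℚ n → Set) (u : Fin m → Vector ℚ n) : Set where
  field
    inside      : ∀ k → W (u k)
    independent : ∀ c → linearCombination c u ≗ const 0ℚ → c ≗ const 0ℚ
    spanning    : ∀ w → W w → ∃ λ c → linearCombination c u ≗ w

HasDimension : ∀ {n} → (Vector ℚ n → Set) → ℕ → Set
HasDimension {n} W m = ∃ λ (u : Fin m → Vector ℚ n) → IsBasis W u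

Eigenspace : ∀ {n} → Matrix n → ℚ → Vector ℚ n → Set
Eigenspace A θ w = ∀ x → (sum λ y → A x y * w y) ≡ θ * w x

occurrences : ℚ → List ℚ → ℕ
occurrences θ Λ = length (filter (θ ≟_) Λ)

-- The multiset Λ (a list up to order) is the spectrum of the symmetric matrix A:
-- every θ occurs in Λ as often as the dimension of its eigenspace, in particular
-- not at all if it is not an eigenvalue.  Scalars are rational; a real symmetric
-- n × n matrix has n real eigenvalues counted with multiplicity, and passing from
-- ℚ to ℝ does not change the dimension of an eigenspace, so requiring n entries
-- in Λ excludes irrational eigenvalues.
record IsSpectrum {n : ℕ} (A : Matrix n) (Λ : List ℚ) : Set where
  field
    size         : length Λ ≡ n
    multiplicity : ∀ θ → HasDimension (Eigenspace A θ) (occurrences θ Λ)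

[_]^_ : ℚ → ℕ → List ℚ
[ θ ]^ m = replicate m θ

infix 6 [_]^_

fromℕ : ℕ → ℚ
fromℕ n = + n / 1

module Submission where

-- Let N be the block-point and C the block-class incidence matrix.  The adjacency
-- matrix is A = N Nᵀ + C Cᵀ - (t + 1) I, and NᵀN = (r - 1) I + J, NᵀC = J, CᵀC = q I
-- with r = (v - 1) / (t - 1) blocks on a point and q = v / t blocks in a class.  So
-- K = N Nᵀ, S = C Cᵀ, I and J span an algebra, in which A² gives the numbers of
-- common neighbours, and I is the sum of symmetric E₀, …, E₃ with A Eᵢ = θᵢ Eᵢ.
-- The sum of the Eᵢ with θᵢ = η is the orthogonal projection onto the eigenspace of
-- η, and the dimension of the image of a projection is its trace.

open import Defs
open import Algebra.Bundles using (CommutativeRing)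
import Algebra.Properties.Semiring.Sum as SemiringSum
open import Data.Bool.Base using (if_then_else_)
open import Data.Fin.Base using (Fin; zero; suc; fromℕ<)
import Data.Fin.Properties as Fin
open import Data.Fin.Subset using (Subset; _∈_; _∩_; ∣_∣; inside; outside)
open import Data.Fin.Subset.Properties using (_∈?_; x∈p∩q⁺; x∈p∩q⁻)
open import Data.Integer.Base as ℤ using (_⊖_)
import Data.Integer.Properties as ℤ
open import Data.List.Base using (List; []; _∷_; _++_; length; filter; allFin)
open import Data.List.Membership.Propositional using () renaming (_∈_ to _∈ˡ_; _∉_ to _∉ˡ_)
open import Data.List.Membership.Propositional.Properties using (∈-allFin)
open import Data.List.Properties using (length-++; length-replicate; filter-++; filter-all; filter-none)
import Data.List.Relation.Unary.All as All
import Data.List.Relation.Unary.All.Properties as All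
open import Data.List.Relation.Unary.AllPairs using ([]; _∷_)
open import Data.List.Relation.Unary.Any using (here; there)
open import Data.Nat.Base as ℕ using (ℕ; zero; suc; NonZero; _∸_; _<_)
import Data.Nat.Properties as ℕ
open import Data.Product using (∃; ∃₂; ∃!; _×_; _,_; proj₁; proj₂; uncurry)
open import Data.Rational.Base using (ℚ; 0ℚ; 1ℚ; _/_; _+_; _-_; -_; _*_; 1/_; _≤_; ≢-nonZero; nonNegative; nonPositive; toℚᵘ)
open import Data.Rational.Properties
import Data.Rational.Unnormalised.Base as ℚᵘ
import Data.Rational.Unnormalised.Properties as ℚᵘ
open import Data.Sum.Base using (inj₁; inj₂; [_,_]′)
open import Data.Unit.Base using (⊤; tt)
open import Data.Vec.Base using ([]; _∷_; tabulate)
open import Data.Vec.Functional using (Vector) renaming (_∷_ to _◂_; [] to ⟨⟩)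
open import Data.Vec.Properties using (lookup∘tabulate; []=⇒lookup; lookup⇒[]=)
open import Function.Base using (_∘_; const; case_of_)
open import Function.Bundles using (mk⇔)
open import Level using (0ℓ)
open import Relation.Binary.PropositionalEquality using (_≡_; _≢_; _≗_; refl; sym; trans; cong; cong₂; subst; module ≡-Reasoning)
open import Relation.Nullary using (¬_; Dec; yes; no; does; contradiction)
open import Relation.Nullary.Decidable using (dec⇒maybe; _×-dec_)
open import Tactic.RingSolver using (solve-∀)
open import Tactic.RingSolver.Core.AlmostCommutativeRing using (AlmostCommutativeRing; fromCommutativeRing)

open SemiringSum (CommutativeRing.semiring +-*-commutativeRing)
  using (sum; sum-cong-≗; ∑-distrib-+; ∑-comm; *-distribˡ-sum; *-distribʳ-sum; sum-replicate-zero)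
open ≡-Reasoning

private variable
  m n k : ℕ

-- The design is known only through incidence counts, so eigenvectors cannot be written down;
-- dimensions must come from traces, which the counts determine. Over ℚ the image of a projection
-- need not have an orthonormal basis, so columns are split off one at a time and divided by their
-- squared norm, which is a diagonal entry. The Eᵢ come from the images of N and C. Both contain the
-- constant vectors; S is q times the projection onto the image of C, K acts as r - 1 on the part of
-- the image of N orthogonal to the constants, and NᵀC = J makes the two images orthogonal apart
-- from the constants. The four values cannot be assumed distinct: θ₁ = θ₂ exactly when v = t².
-- Projections are therefore attached to a value η, and the multiplicities of coinciding values add
-- up by themselves. Integrality is never a divisibility argument: r is the number of parts, the
-- valency is a degree, and f₃ is a dimension.

ℚ-ring : AlmostCommutativeRing 0ℓ 0ℓ
ℚ-ring = fromCommutativeRing +-*-commutativeRing (λ x → dec⇒maybe (0ℚ ≟ x))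

-- Arithmetic in ℚ and the embedding of ℕ

inverse : ∀ {p} → p ≢ 0ℚ → ∃ λ d → d * p ≡ 1ℚ
inverse {p} p≢0 = (1/ p) {{≢-nonZero p≢0}} , *-inverseˡ p {{≢-nonZero p≢0}}

*-cancelˡ : ∀ {p x y} → p ≢ 0ℚ → p * x ≡ p * y → x ≡ y
*-cancelˡ {p} {x} {y} p≢0 px≡py = begin
  x            ≡⟨ *-identityˡ x ⟨
  1ℚ * x       ≡⟨ cong (_* x) dp≡1 ⟨
  d * p * x    ≡⟨ *-assoc d p x ⟩
  d * (p * x)  ≡⟨ cong (d *_) px≡py ⟩
  d * (p * y)  ≡⟨ *-assoc d p y ⟨
  d * p * y    ≡⟨ cong (_* y) dp≡1 ⟩
  1ℚ * y       ≡⟨ *-identityˡ y ⟩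
  y            ∎
  where
  d = proj₁ (inverse p≢0)
  dp≡1 = proj₂ (inverse p≢0)

x*y≡0⇒y≡0 : ∀ {p x} → p ≢ 0ℚ → p * x ≡ 0ℚ → x ≡ 0ℚ
x*y≡0⇒y≡0 {p} p≢0 px≡0 = *-cancelˡ p≢0 (trans px≡0 (sym (*-zeroʳ p)))

p-q≡0⇒p≡q : ∀ {p q} → p - q ≡ 0ℚ → p ≡ q
p-q≡0⇒p≡q {p} {q} eq = begin
  p            ≡⟨ lemma p q ⟩
  (p - q) + q  ≡⟨ cong (_+ q) eq ⟩
  0ℚ + q       ≡⟨ +-identityˡ q ⟩
  q            ∎
  where
  lemma : ∀ p q → p ≡ (p - q) + q
  lemma = solve-∀ ℚ-ring

square-nonNeg : ∀ p → 0ℚ ≤ p * p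
square-nonNeg p = nonNegative⁻¹ (p * p) {{p*p-nonNeg}}
  where
  p*p-nonNeg = [ (λ 0≤p → let instance _ = nonNegative 0≤p in nonNeg*nonNeg⇒nonNeg p p)
               , (λ p≤0 → let instance _ = nonPositive p≤0 in nonPos*nonPos⇒nonPos p p) ]′ (≤-total 0ℚ p)

square≡0⇒≡0 : ∀ p → p * p ≡ 0ℚ → p ≡ 0ℚ
square≡0⇒≡0 p eq with p ≟ 0ℚ
... | yes p≡0 = p≡0
... | no  p≢0 = x*y≡0⇒y≡0 p≢0 eq

-- An equation that follows linearly from hypotheses l ≡ h: the ring solver checks the coefficients.
by-relation : ∀ {x y l h} c → x - y ≡ c * (l - h) → l ≡ h → x ≡ y
by-relation {h = h} c eq refl = p-q≡0⇒p≡q (trans eq (trans (cong (c *_) (+-inverseʳ h)) (*-zeroʳ c)))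

by-relations : ∀ {x y l₁ h₁ l₂ h₂} c₁ c₂ → x - y ≡ c₁ * (l₁ - h₁) + c₂ * (l₂ - h₂) → l₁ ≡ h₁ → l₂ ≡ h₂ → x ≡ y
by-relations {h₁ = h₁} {h₂ = h₂} c₁ c₂ eq refl refl = p-q≡0⇒p≡q (trans eq (cong₂ _+_
  (trans (cong (c₁ *_) (+-inverseʳ h₁)) (*-zeroʳ c₁)) (trans (cong (c₂ *_) (+-inverseʳ h₂)) (*-zeroʳ c₂))))

by-relations₃ : ∀ {x y l₁ h₁ l₂ h₂ l₃ h₃} c₁ c₂ c₃ →
                x - y ≡ c₁ * (l₁ - h₁) + c₂ * (l₂ - h₂) + c₃ * (l₃ - h₃) →
                l₁ ≡ h₁ → l₂ ≡ h₂ → l₃ ≡ h₃ → x ≡ y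
by-relations₃ {l₁ = l₁} {h₁ = h₁} {l₂ = l₂} {h₂ = h₂} {h₃ = h₃} c₁ c₂ c₃ eq l₁≡h₁ l₂≡h₂ refl =
  by-relations c₁ c₂ (trans eq (trans (cong (c₁ * (l₁ - h₁) + c₂ * (l₂ - h₂) +_)
    (trans (cong (c₃ *_) (+-inverseʳ h₃)) (*-zeroʳ c₃))) (+-identityʳ (c₁ * (l₁ - h₁) + c₂ * (l₂ - h₂))))) l₁≡h₁ l₂≡h₂

-- `i / n` is reduced by a gcd. In unnormalised rationals the same fraction is kept as it stands,
-- and equations become cross-multiplied equations of integers.
/1-≃ : ∀ i n .{{_ : NonZero n}} → toℚᵘ (i / n) ℚᵘ.≃ (i ℚᵘ./ n)
/1-≃ i (suc n) = toℚᵘ-fromℚᵘ (ℚᵘ.mkℚᵘ i n)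

-- The way to remove the denominators `t` and `t ∸ 1` of the statement: each quotient is identified
-- by its product with its denominator.
/-*-cancel : ∀ i n .{{_ : NonZero n}} → (i / n) * fromℕ n ≡ i / 1
/-*-cancel i n@(suc _) = toℚᵘ-injective (ℚᵘ.≃-trans (toℚᵘ-homo-* (i / n) (fromℕ n))
  (ℚᵘ.≃-trans (ℚᵘ.*-cong (/1-≃ i n) (/1-≃ (ℤ.+ n) 1))
  (ℚᵘ.≃-trans (ℚᵘ.*≡* (trans (ℤ.*-identityʳ _) (cong (λ d → i ℤ.* ℤ.+ d) (sym (ℕ.*-identityʳ n))))) (ℚᵘ.≃-sym (/1-≃ i 1)))))

/1-homo-+ : ∀ i j → (i ℤ.+ j) / 1 ≡ i / 1 + j / 1
/1-homo-+ i j = toℚᵘ-injective (ℚᵘ.≃-trans (/1-≃ (i ℤ.+ j) 1) (ℚᵘ.≃-sym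
  (ℚᵘ.≃-trans (toℚᵘ-homo-+ (i / 1) (j / 1)) (ℚᵘ.≃-trans (ℚᵘ.+-cong (/1-≃ i 1) (/1-≃ j 1))
  (ℚᵘ.*≡* (cong (ℤ._* ℤ.+ 1) (cong₂ ℤ._+_ (ℤ.*-identityʳ i) (ℤ.*-identityʳ j))))))))

/1-homo-* : ∀ i j → (i ℤ.* j) / 1 ≡ (i / 1) * (j / 1)
/1-homo-* i j = toℚᵘ-injective (ℚᵘ.≃-trans (/1-≃ (i ℤ.* j) 1) (ℚᵘ.≃-sym
  (ℚᵘ.≃-trans (toℚᵘ-homo-* (i / 1) (j / 1)) (ℚᵘ.≃-trans (ℚᵘ.*-cong (/1-≃ i 1) (/1-≃ j 1)) (ℚᵘ.*≡* refl)))))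

/1-injective : ∀ {i j} → i / 1 ≡ j / 1 → i ≡ j
/1-injective {i} {j} eq with ℚᵘ.≃-trans (ℚᵘ.≃-sym (/1-≃ i 1)) (ℚᵘ.≃-trans (ℚᵘ.≃-reflexive (cong toℚᵘ eq)) (/1-≃ j 1))
... | ℚᵘ.*≡* i*1≡j*1 = trans (sym (ℤ.*-identityʳ i)) (trans i*1≡j*1 (ℤ.*-identityʳ j))

fromℕ-injective : ∀ i j → fromℕ i ≡ fromℕ j → i ≡ j
fromℕ-injective i j eq = ℤ.+-injective (/1-injective eq)

fromℕ-+ : ∀ i j → fromℕ (i ℕ.+ j) ≡ fromℕ i + fromℕ j
fromℕ-+ i j = /1-homo-+ (ℤ.+ i) (ℤ.+ j)

fromℕ-* : ∀ i j → fromℕ (i ℕ.* j) ≡ fromℕ i * fromℕ j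
fromℕ-* i j = trans (cong (_/ 1) (ℤ.pos-* i j)) (/1-homo-* (ℤ.+ i) (ℤ.+ j))

⊖/1 : ∀ i j → (i ⊖ j) / 1 ≡ fromℕ i - fromℕ j
⊖/1 i j = begin
  (i ⊖ j) / 1                        ≡⟨ ring ((i ⊖ j) / 1) (fromℕ j) ⟩
  (i ⊖ j) / 1 + fromℕ j - fromℕ j    ≡⟨ cong (_- fromℕ j) (/1-homo-+ (i ⊖ j) (ℤ.+ j)) ⟨
  (i ⊖ j ℤ.+ ℤ.+ j) / 1 - fromℕ j    ≡⟨ cong (λ h → h / 1 - fromℕ j) cancel ⟩
  fromℕ i - fromℕ j                  ∎
  where
  ring : ∀ a b → a ≡ a + b - b
  ring = solve-∀ ℚ-ring
  cancel : i ⊖ j ℤ.+ ℤ.+ j ≡ ℤ.+ i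
  cancel = trans (cong (ℤ._+ ℤ.+ j) (sym (ℤ.m-n≡m⊖n i j)))
    (trans (ℤ.+-assoc (ℤ.+ i) (ℤ.- ℤ.+ j) (ℤ.+ j))
      (trans (cong (λ h → ℤ.+ i ℤ.+ h) (ℤ.+-inverseˡ (ℤ.+ j))) (ℤ.+-identityʳ (ℤ.+ i))))

-- Truncated subtraction agrees with the rational one only for positive `n`; an element of `Fin n`
-- is the evidence, since a point or a part is what is at hand.
fromℕ-pred : Fin n → fromℕ (n ∸ 1) ≡ fromℕ n - 1ℚ
fromℕ-pred {suc n} _ = begin
  fromℕ n                  ≡⟨ ring (fromℕ n) ⟩
  1ℚ + fromℕ n - 1ℚ        ≡⟨ cong (_- 1ℚ) (fromℕ-+ 1 n) ⟨
  fromℕ (suc n) - 1ℚ       ∎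
  where
  ring : ∀ a → a ≡ 1ℚ + a - 1ℚ
  ring = solve-∀ ℚ-ring

fromℕ≢0 : ∀ n .{{_ : NonZero n}} → fromℕ n ≢ 0ℚ
fromℕ≢0 (suc n) eq = ℕ.1+n≢0 (fromℕ-injective (suc n) 0 eq)

-- Sums and matrices

sum-0 : {f : Vector ℚ n} → f ≗ const 0ℚ → sum f ≡ 0ℚ
sum-0 {n} f≗0 = trans (sum-cong-≗ f≗0) (sum-replicate-zero n)

sum-nonNeg : (f : Vector ℚ n) → (∀ x → 0ℚ ≤ f x) → 0ℚ ≤ sum f
sum-nonNeg {zero}  f 0≤f = ≤-refl
sum-nonNeg {suc n} f 0≤f = +-mono-≤ (0≤f zero) (sum-nonNeg (f ∘ suc) (0≤f ∘ suc))

sum-nonNeg≡0 : (f : Vector ℚ n) → (∀ x → 0ℚ ≤ f x) → sum f ≡ 0ℚ → f ≗ const 0ℚ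
sum-nonNeg≡0 {suc n} f 0≤f eq = λ
  { zero    → f₀≡0
  ; (suc x) → sum-nonNeg≡0 (f ∘ suc) (0≤f ∘ suc) (trans (sym (+-identityˡ (sum (f ∘ suc)))) (trans (cong (_+ sum (f ∘ suc)) (sym f₀≡0)) eq)) x
  }
  where
  f₀≡0 : f zero ≡ 0ℚ
  f₀≡0 = ≤-antisym
    (subst (f zero ≤_) eq
      (subst (_≤ sum f) (+-identityʳ (f zero)) (+-monoʳ-≤ (f zero) (sum-nonNeg (f ∘ suc) (0≤f ∘ suc)))))
    (0≤f zero)

sum-single : (i : Fin n) (f : Vector ℚ n) → (∀ j → j ≢ i → f j ≡ 0ℚ) → sum f ≡ f i
sum-single zero    f f≡0 = trans (cong (f zero +_) (sum-0 λ j → f≡0 (suc j) λ ())) (+-identityʳ _)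
sum-single (suc i) f f≡0 =
  trans (cong₂ _+_ (f≡0 zero λ ()) (sum-single i (f ∘ suc) λ j j≢i → f≡0 (suc j) (j≢i ∘ Fin.suc-injective)))
        (+-identityˡ _)

sum-const : ∀ n c → (sum {n} λ _ → c) ≡ fromℕ n * c
sum-const zero    c = sym (*-zeroˡ c)
sum-const (suc n) c = begin
  c + (sum {n} λ _ → c)  ≡⟨ cong (c +_) (sum-const n c) ⟩
  c + fromℕ n * c        ≡⟨ ring c (fromℕ n) ⟩
  (1ℚ + fromℕ n) * c     ≡⟨ cong (_* c) (fromℕ-+ 1 n) ⟨
  fromℕ (suc n) * c      ∎
  where
  ring : ∀ c n → c + n * c ≡ (1ℚ + n) * c
  ring = solve-∀ ℚ-ring

sum₄ : (f : Vector ℚ 4) → sum f ≡ f zero + (f (suc zero) + (f (suc (suc zero)) + (f (suc (suc (suc zero))) + 0ℚ)))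
sum₄ f = refl

indicator : ∀ {a} {P : Set a} → Dec P → ℚ
indicator P? = if does P? then 1ℚ else 0ℚ

indicator-yes : ∀ {a} {P : Set a} (P? : Dec P) → P → indicator P? ≡ 1ℚ
indicator-yes (yes _) _ = refl
indicator-yes (no ¬p) p = contradiction p ¬p

indicator-no : ∀ {a} {P : Set a} (P? : Dec P) → ¬ P → indicator P? ≡ 0ℚ
indicator-no (yes p) ¬p = contradiction p ¬p
indicator-no (no _)  _  = refl

indicator-× : ∀ {a b} {P : Set a} {Q : Set b} (P? : Dec P) (Q? : Dec Q) →
              indicator (P? ×-dec Q?) ≡ indicator P? * indicator Q?
indicator-× (yes _) Q? = sym (*-identityˡ (indicator Q?))
indicator-× (no _)  Q? = sym (*-zeroˡ (indicator Q?))

indicator-square : ∀ {a} {P : Set a} (P? : Dec P) → indicator P? * indicator P? ≡ indicator P?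
indicator-square (yes _) = refl
indicator-square (no _)  = refl

-- Turns the unique existence in the axioms of designs and partitions into an incidence count.
sum-indicator-∃! : {P : Fin n → Set} (P? : ∀ x → Dec (P x)) → ∃! _≡_ P → (sum λ x → indicator (P? x)) ≡ 1ℚ
sum-indicator-∃! P? (x , px , unique) = trans
  (sum-single x (λ y → indicator (P? y)) λ y y≢x → indicator-no (P? y) λ py → y≢x (sym (unique py)))
  (indicator-yes (P? x) px)

sum-indicator-∅ : {P : Fin n → Set} (P? : ∀ x → Dec (P x)) → (∀ x → ¬ P x) → (sum λ x → indicator (P? x)) ≡ 0ℚ
sum-indicator-∅ P? ¬P = sum-0 λ x → indicator-no (P? x) (¬P x)

sum-indicator-×-∃! : {P Q : Fin n → Set} (P? : ∀ x → Dec (P x)) (Q? : ∀ x → Dec (Q x)) →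
                     ∃! _≡_ (λ x → P x × Q x) → (sum λ x → indicator (P? x) * indicator (Q? x)) ≡ 1ℚ
sum-indicator-×-∃! P? Q? ∃!PQ = trans (sum-cong-≗ λ x → sym (indicator-× (P? x) (Q? x)))
  (sum-indicator-∃! (λ x → P? x ×-dec Q? x) ∃!PQ)

sum-indicator-×-∅ : {P Q : Fin n → Set} (P? : ∀ x → Dec (P x)) (Q? : ∀ x → Dec (Q x)) →
                    (∀ x → P x → ¬ Q x) → (sum λ x → indicator (P? x) * indicator (Q? x)) ≡ 0ℚ
sum-indicator-×-∅ P? Q? disjoint = trans (sum-cong-≗ λ x → sym (indicator-× (P? x) (Q? x)))
  (sum-indicator-∅ (λ x → P? x ×-dec Q? x) λ x (px , qx) → disjoint x px qx)

infixr 7 _▹_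

-- This also serves as the matrix product, column by column: the entry of M M′ at `x`, `z` is
-- `(M ▹ λ y → M′ y z) x`.
_▹_ : (Fin m → Fin n → ℚ) → Vector ℚ n → Vector ℚ m
(M ▹ w) x = sum λ y → M x y * w y

▹-cong : (M : Fin m → Fin n → ℚ) {w w′ : Vector ℚ n} → w ≗ w′ → M ▹ w ≗ M ▹ w′
▹-cong M w≗w′ x = sum-cong-≗ λ y → cong (M x y *_) (w≗w′ y)

▹-*ʳ : (M : Fin m → Fin n → ℚ) (w : Vector ℚ n) (c : ℚ) (x : Fin m) →
       (M ▹ λ y → w y * c) x ≡ (M ▹ w) x * c
▹-*ʳ M w c x = trans (sum-cong-≗ λ y → sym (*-assoc (M x y) (w y) c)) (sym (*-distribʳ-sum c λ y → M x y * w y))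

▹-+ : (M : Fin m → Fin n → ℚ) (w w′ : Vector ℚ n) (x : Fin m) →
      (M ▹ λ y → w y + w′ y) x ≡ (M ▹ w) x + (M ▹ w′) x
▹-+ M w w′ x = trans (sum-cong-≗ λ y → *-distribˡ-+ (M x y) (w y) (w′ y)) (∑-distrib-+ (λ y → M x y * w y) _)

▹-assoc : (M : Fin m → Fin n → ℚ) (M′ : Fin n → Fin k → ℚ) (w : Vector ℚ k) (x : Fin m) →
          (M ▹ M′ ▹ w) x ≡ ((λ s z → (M ▹ λ y → M′ y z) s) ▹ w) x
▹-assoc M M′ w x = begin
  (sum λ y → M x y * (sum λ z → M′ y z * w z))    ≡⟨ sum-cong-≗ (λ y → *-distribˡ-sum (M x y) (λ z → M′ y z * w z)) ⟩
  (sum λ y → sum λ z → M x y * (M′ y z * w z))    ≡⟨ ∑-comm (λ y z → M x y * (M′ y z * w z)) ⟩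
  (sum λ z → sum λ y → M x y * (M′ y z * w z))    ≡⟨ sum-cong-≗ (λ z → ▹-*ʳ M (λ y → M′ y z) (w z) x) ⟩
  (sum λ z → (M ▹ λ y → M′ y z) x * w z)          ∎

▹-congˡ : {M M′ : Fin m → Fin n → ℚ} → (∀ x y → M x y ≡ M′ x y) → (w : Vector ℚ n) → M ▹ w ≗ M′ ▹ w
▹-congˡ M≗M′ w x = sum-cong-≗ λ y → cong (_* w y) (M≗M′ x y)

▹-0 : (M : Fin m → Fin n → ℚ) {w : Vector ℚ n} (x : Fin m) → (∀ y → M x y ≡ 0ℚ) → (M ▹ w) x ≡ 0ℚ
▹-0 M {w} x M≡0 = sum-0 λ y → trans (cong (_* w y) (M≡0 y)) (*-zeroˡ (w y))

▹-sum : (M : Fin m → Fin n → ℚ) (f : Fin k → Vector ℚ n) (x : Fin m) →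
        (M ▹ λ y → sum λ i → f i y) x ≡ sum λ i → (M ▹ f i) x
▹-sum M f x = trans (sum-cong-≗ λ y → *-distribˡ-sum (M x y) λ i → f i y) (∑-comm λ y i → M x y * f i y)

trace : Matrix n → ℚ
trace M = sum λ x → M x x

▹-constant : (M : Fin n → Fin m → ℚ) (c h : ℚ) → ∀ x → sum (M x) ≡ h → (M ▹ λ _ → c) x ≡ h * c
▹-constant M c h x row = trans (sym (*-distribʳ-sum c (M x))) (cong (_* c) row)

δ : Matrix n
δ x y = indicator (x Fin.≟ y)

δ-▹ : (w : Vector ℚ n) → δ ▹ w ≗ w
δ-▹ w x = begin
  (δ ▹ w) x      ≡⟨ sum-single x (λ y → δ x y * w y) off ⟩
  δ x x * w x    ≡⟨ cong (_* w x) (indicator-yes (x Fin.≟ x) refl) ⟩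
  1ℚ * w x       ≡⟨ *-identityˡ (w x) ⟩
  w x            ∎
  where
  off : ∀ y → y ≢ x → δ x y * w y ≡ 0ℚ
  off y y≢x = trans (cong (_* w y) (indicator-no (x Fin.≟ y) (y≢x ∘ sym))) (*-zeroˡ (w y))

δ-symmetric : (x y : Fin n) → δ x y ≡ δ y x
δ-symmetric x y with x Fin.≟ y
... | yes refl = sym (indicator-yes (x Fin.≟ x) refl)
... | no  x≢y  = sym (indicator-no (y Fin.≟ x) (x≢y ∘ sym))

-- Projections

Fixed : Matrix n → Vector ℚ n → Set
Fixed E w = E ▹ w ≗ w

record IsProjection (E : Matrix n) : Set where
  field
    symmetric  : ∀ x y → E x y ≡ E y x
    idempotent : ∀ z → Fixed E λ y → E y z

linearCombination-◂ : (a : ℚ) (c : Vector ℚ m) (g : Vector ℚ n) (u : Fin m → Vector ℚ n) (x : Fin n) →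
                      linearCombination (a ◂ c) (g ◂ u) x ≡ a * g x + linearCombination c u x
linearCombination-◂ a c g u x = refl

-- With d = 1 / E p p this removes the rank-one projection onto the p-th column of E.
deflate : Matrix n → Fin n → ℚ → Matrix n
deflate E p d x y = E x y + E x p * (- (d * E p y))

▹-deflate : (E : Matrix n) (p : Fin n) (d : ℚ) (w : Vector ℚ n) (x : Fin n) →
            (deflate E p d ▹ w) x ≡ (E ▹ w) x + E x p * (- (d * (E ▹ w) p))
▹-deflate E p d w x = begin
  (sum λ y → (E x y + E x p * (- (d * E p y))) * w y)
    ≡⟨ sum-cong-≗ (λ y → lemma₁ (E x y) (E x p) d (E p y) (w y)) ⟩
  (sum λ y → E x y * w y + E x p * (- d) * (E p y * w y))
    ≡⟨ ∑-distrib-+ (λ y → E x y * w y) _ ⟩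
  (E ▹ w) x + (sum λ y → E x p * (- d) * (E p y * w y))
    ≡⟨ cong ((E ▹ w) x +_) (*-distribˡ-sum (E x p * (- d)) (λ y → E p y * w y)) ⟨
  (E ▹ w) x + E x p * (- d) * (E ▹ w) p
    ≡⟨ lemma₂ ((E ▹ w) x) (E x p) d ((E ▹ w) p) ⟩
  (E ▹ w) x + E x p * (- (d * (E ▹ w) p)) ∎
  where
  lemma₁ : ∀ a b d c w → (a + b * (- (d * c))) * w ≡ a * w + b * (- d) * (c * w)
  lemma₁ = solve-∀ ℚ-ring
  lemma₂ : ∀ a b d c → a + b * (- d) * c ≡ a + b * (- (d * c))
  lemma₂ = solve-∀ ℚ-ring

-- The image of `E` is the orthogonal sum of the line through its `p`-th column and the image of
-- `E′`, so trace and dimension both drop by one. The squared norm of that column is `E p p`,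
-- because E = Eᵀ = E²; dividing by it keeps everything rational.
module Deflation {n : ℕ} {E : Matrix n} (proj : IsProjection E) (p : Fin n) (d : ℚ) (dEpp≡1 : d * E p p ≡ 1ℚ) where
  open IsProjection proj

  E′ : Matrix n
  E′ = deflate E p d

  -- `E′` is a Schur complement with pivot `E p p`, which clears the pivot row and, by symmetry, the
  -- pivot column.
  E′-row-p : ∀ z → E′ p z ≡ 0ℚ
  E′-row-p z = begin
    E p z + E p p * (- (d * E p z))  ≡⟨ ring (E p z) (E p p) d ⟩
    E p z + E p z * (- (d * E p p))  ≡⟨ cong (λ h → E p z + E p z * (- h)) dEpp≡1 ⟩
    E p z + E p z * (- 1ℚ)           ≡⟨ ring₂ (E p z) ⟩
    0ℚ                               ∎
    where
    ring : ∀ a b d → a + b * (- (d * a)) ≡ a + a * (- (d * b))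
    ring = solve-∀ ℚ-ring
    ring₂ : ∀ a → a + a * (- 1ℚ) ≡ 0ℚ
    ring₂ = solve-∀ ℚ-ring

  E′-symmetric : ∀ x y → E′ x y ≡ E′ y x
  E′-symmetric x y = begin
    E x y + E x p * (- (d * E p y))  ≡⟨ cong₂ _+_ (symmetric x y) (cong₂ (λ a b → a * (- (d * b))) (symmetric x p) (symmetric p y)) ⟩
    E y x + E p x * (- (d * E y p))  ≡⟨ ring (E y x) (E p x) d (E y p) ⟩
    E y x + E y p * (- (d * E p x))  ∎
    where
    ring : ∀ a b d c → a + b * (- (d * c)) ≡ a + c * (- (d * b))
    ring = solve-∀ ℚ-ring

  E-fixes-E′ : ∀ z → Fixed E λ y → E′ y z
  E-fixes-E′ z x = begin
    (E ▹ λ y → E y z + E y p * (- (d * E p z))) x        ≡⟨ ▹-+ E (λ y → E y z) _ x ⟩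
    (E ▹ λ y → E y z) x + (E ▹ λ y → E y p * (- (d * E p z))) x
      ≡⟨ cong₂ _+_ (idempotent z x) (trans (▹-*ʳ E (λ y → E y p) _ x) (cong (_* (- (d * E p z))) (idempotent p x))) ⟩
    E′ x z ∎

  -- `E` fixes the columns of `E′`, and there `E′` differs from `E` only by a multiple of the value
  -- at `p`, which is 0.
  E′-fixes-E′ : ∀ z → Fixed E′ λ y → E′ y z
  E′-fixes-E′ z x = begin
    (E′ ▹ w) x                               ≡⟨ ▹-deflate E p d w x ⟩
    (E ▹ w) x + E x p * (- (d * (E ▹ w) p))  ≡⟨ cong₂ (λ a b → a + E x p * (- (d * b))) (E-fixes-E′ z x) (trans (E-fixes-E′ z p) (E′-row-p z)) ⟩
    E′ x z + E x p * (- (d * 0ℚ))            ≡⟨ ring (E′ x z) (E x p) d ⟩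
    E′ x z                                   ∎
    where
    w : Vector ℚ n
    w y = E′ y z
    ring : ∀ a b d → a + b * (- (d * 0ℚ)) ≡ a
    ring = solve-∀ ℚ-ring

  E′-projection : IsProjection E′
  E′-projection = record { symmetric = E′-symmetric ; idempotent = E′-fixes-E′ }

  -- Cleared columns stay cleared, because the correction in column `y` contains the factor `E p y`
  -- of the same column. So one pass over all columns exhausts the projection.
  E′-support : ∀ {L} → (∀ y → y ∉ˡ p ∷ L → ∀ x → E x y ≡ 0ℚ) → ∀ y → y ∉ˡ L → ∀ x → E′ x y ≡ 0ℚ
  E′-support {L} E≡0 y y∉L x with y Fin.≟ p
  ... | yes refl = trans (E′-symmetric x p) (E′-row-p x)
  ... | no  y≢p  = trans (cong₂ (λ a b → a + E x p * (- (d * b))) (E≡0 y y∉pL x) (E≡0 y y∉pL p)) (ring (E x p) d)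
    where
    y∉pL : y ∉ˡ p ∷ L
    y∉pL = λ { (here y≡p) → y≢p y≡p ; (there y∈L) → y∉L y∈L }
    ring : ∀ a d → 0ℚ + a * (- (d * 0ℚ)) ≡ 0ℚ
    ring = solve-∀ ℚ-ring

  E-fixes : ∀ {w} → Fixed E′ w → Fixed E w
  E-fixes {w} E′w≗w x = begin
    (E ▹ w) x                                ≡⟨ ▹-cong E E′w≗w x ⟨
    (E ▹ E′ ▹ w) x                           ≡⟨ ▹-assoc E E′ w x ⟩
    ((λ s z → (E ▹ λ y → E′ y z) s) ▹ w) x   ≡⟨ ▹-congˡ (λ s z → E-fixes-E′ z s) w x ⟩
    (E′ ▹ w) x                               ≡⟨ E′w≗w x ⟩
    w x                                      ∎

  E′-image : ∀ w → Fixed E′ (E′ ▹ w)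
  E′-image w x = trans (▹-assoc E′ E′ w x) (▹-congˡ (λ s z → E′-fixes-E′ z s) w x)

  -- The rank-one matrix taken away has trace `d` times (E²) at `p`, `p`, that is `d * E p p`, which
  -- is 1.
  trace-E′ : trace E ≡ 1ℚ + trace E′
  trace-E′ = sym (begin
    1ℚ + (sum λ x → E x x + E x p * (- (d * E p x)))
      ≡⟨ cong (1ℚ +_) (sum-cong-≗ λ x → ring (E x x) (E x p) d (E p x)) ⟩
    1ℚ + (sum λ x → E x x + (- d) * (E p x * E x p))
      ≡⟨ cong (1ℚ +_) (∑-distrib-+ (λ x → E x x) _) ⟩
    1ℚ + (trace E + (sum λ x → (- d) * (E p x * E x p)))
      ≡⟨ cong (λ h → 1ℚ + (trace E + h)) (*-distribˡ-sum (- d) λ x → E p x * E x p) ⟨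
    1ℚ + (trace E + (- d) * (E ▹ λ x → E x p) p)
      ≡⟨ cong (λ h → 1ℚ + (trace E + (- d) * h)) (idempotent p p) ⟩
    1ℚ + (trace E + (- d) * E p p)
      ≡⟨ ring₂ (trace E) d (E p p) ⟩
    1ℚ + (trace E - d * E p p)
      ≡⟨ cong (λ h → 1ℚ + (trace E - h)) dEpp≡1 ⟩
    1ℚ + (trace E - 1ℚ)
      ≡⟨ ring₃ (trace E) ⟩
    trace E ∎)
    where
    ring : ∀ a b d c → a + b * (- (d * c)) ≡ a + (- d) * (c * b)
    ring = solve-∀ ℚ-ring
    ring₂ : ∀ a d e → 1ℚ + (a + (- d) * e) ≡ 1ℚ + (a - d * e)
    ring₂ = solve-∀ ℚ-ring
    ring₃ : ∀ a → 1ℚ + (a - 1ℚ) ≡ a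
    ring₃ = solve-∀ ℚ-ring

  extend-basis : HasDimension (Fixed E′) m → HasDimension (Fixed E) (suc m)
  extend-basis {m} (u , basis) = g ◂ u , record
    { inside      = λ { zero → idempotent p ; (suc k) → E-fixes (B.inside k) }
    ; independent = independent′
    ; spanning    = spanning′
    }
    where
    module B = IsBasis basis
    g : Vector ℚ n
    g y = E y p

    Epp≢0 : E p p ≢ 0ℚ
    Epp≢0 eq = contradiction (trans (sym dEpp≡1) (trans (cong (d *_) eq) (*-zeroʳ d))) λ ()

    -- Row `p` of `E′` is zero, so evaluation at `p` isolates the coefficient of `g` in a linear
    -- combination.
    u-p : ∀ k → u k p ≡ 0ℚ
    u-p k = trans (sym (B.inside k p)) (▹-0 E′ p E′-row-p)

    independent′ : ∀ c → linearCombination c (g ◂ u) ≗ const 0ℚ → c ≗ const 0ℚ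
    independent′ c eq = λ { zero → c₀≡0 ; (suc k) → B.independent (c ∘ suc) rest k }
      where
      c₀≡0 : c zero ≡ 0ℚ
      c₀≡0 = x*y≡0⇒y≡0 Epp≢0 (begin
        E p p * c zero       ≡⟨ *-comm (E p p) (c zero) ⟩
        c zero * E p p       ≡⟨ +-identityʳ (c zero * E p p) ⟨
        c zero * E p p + 0ℚ  ≡⟨ cong (c zero * E p p +_) (sum-0 λ k → trans (cong (c (suc k) *_) (u-p k)) (*-zeroʳ (c (suc k)))) ⟨
        linearCombination c (g ◂ u) p ≡⟨ eq p ⟩
        0ℚ ∎)
      rest : linearCombination (c ∘ suc) u ≗ const 0ℚ
      rest x = begin
        linearCombination (c ∘ suc) u x        ≡⟨ +-identityˡ (linearCombination (c ∘ suc) u x) ⟨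
        0ℚ + linearCombination (c ∘ suc) u x   ≡⟨ cong (_+ linearCombination (c ∘ suc) u x) (trans (cong (_* E x p) c₀≡0) (*-zeroˡ (E x p))) ⟨
        linearCombination c (g ◂ u) x          ≡⟨ eq x ⟩
        0ℚ ∎

    spanning′ : ∀ w → Fixed E w → ∃ λ c → linearCombination c (g ◂ u) ≗ w
    -- As E w = w, the inner product of `w` with `g` is `w p`; hence `d * w p` is its Fourier
    -- coefficient, and what remains is E′ w.
    spanning′ w Ew≗w = (d * w p) ◂ c , λ x → begin
      linearCombination ((d * w p) ◂ c) (g ◂ u) x
        ≡⟨ linearCombination-◂ (d * w p) c g u x ⟩
      d * w p * E x p + linearCombination c u x
        ≡⟨ cong (d * w p * E x p +_) (trans (eq x) (▹-deflate E p d w x)) ⟩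
      d * w p * E x p + ((E ▹ w) x + E x p * (- (d * (E ▹ w) p)))
        ≡⟨ cong₂ (λ a b → d * w p * E x p + (a + E x p * (- (d * b)))) (Ew≗w x) (Ew≗w p) ⟩
      d * w p * E x p + (w x + E x p * (- (d * w p)))
        ≡⟨ ring d (w p) (E x p) (w x) ⟩
      w x ∎
      where
      c : Vector ℚ _
      c = proj₁ (B.spanning (E′ ▹ w) (E′-image w))
      eq : linearCombination c u ≗ E′ ▹ w
      eq = proj₂ (B.spanning (E′ ▹ w) (E′-image w))
      ring : ∀ d a b c → d * a * b + (c + b * (- (d * a))) ≡ c
      ring = solve-∀ ℚ-ring

-- By symmetry and idempotence `E p p` is the sum of the squares of column `p`, and in an ordered
-- field such a sum vanishes only termwise. A zero pivot thus means that the column is already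
-- clear.
projection-diagonal≡0 : {E : Matrix n} → IsProjection E → ∀ p → E p p ≡ 0ℚ → ∀ x → E x p ≡ 0ℚ
projection-diagonal≡0 {E = E} proj p Epp≡0 x = square≡0⇒≡0 (E x p)
  (sum-nonNeg≡0 (λ y → E y p * E y p) (λ y → square-nonNeg (E y p)) eq x)
  where
  open IsProjection proj
  eq : (sum λ y → E y p * E y p) ≡ 0ℚ
  eq = trans (sum-cong-≗ λ y → cong (_* E y p) (symmetric y p)) (trans (idempotent p p) Epp≡0)

-- L lists the columns that have not been cleared by deflation yet.
projection-dimension : (L : List (Fin n)) {E : Matrix n} → IsProjection E →
                       (∀ y → y ∉ˡ L → ∀ x → E x y ≡ 0ℚ) →
                       ∃ λ m → fromℕ m ≡ trace E × HasDimension (Fixed E) m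
projection-dimension [] {E} proj E≡0 = 0 , sym (sum-0 λ x → E≡0 x (λ ()) x) , (λ ()) , record
  { inside      = λ ()
  ; independent = λ _ _ ()
  ; spanning    = λ w Ew≗w → (λ ()) , λ x → trans (sym (▹-0 E x λ y → E≡0 y (λ ()) x)) (Ew≗w x)
  }
projection-dimension (p ∷ L) {E} proj E≡0 with E p p ≟ 0ℚ
... | yes Epp≡0 = projection-dimension L proj λ y y∉L → case y Fin.≟ p of λ
  { (yes refl) → projection-diagonal≡0 proj p Epp≡0
  ; (no  y≢p)  → E≡0 y λ { (here y≡p) → y≢p y≡p ; (there y∈L) → y∉L y∈L }
  }
... | no  Epp≢0 with inverse Epp≢0
...   | d , dEpp≡1 with projection-dimension L E′-projection (E′-support E≡0)
  where open Deflation proj p d dEpp≡1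
...     | m , m≡trace , dim =
  suc m , trans (fromℕ-+ 1 m) (trans (cong (1ℚ +_) m≡trace) (sym trace-E′)) , extend-basis dim
  where open Deflation proj p d dEpp≡1

-- Spectra

-- The resolution is labelled by indices and not by eigenvalues, so entries of `θ` may repeat. For η
-- outside `θ` the projector is zero, which shows that η is not an eigenvalue.
module SpectralResolution
  {n s : ℕ} {A : Matrix n} (A-symmetric : ∀ x y → A x y ≡ A y x)
  (θ : Vector ℚ s) (E : Fin s → Matrix n)
  (E-symmetric : ∀ i x y → E i x y ≡ E i y x)
  (E-eigen : ∀ i z → Eigenspace A (θ i) λ y → E i y z)
  (E-complete : ∀ x y → (sum λ i → E i x y) ≡ δ x y)
  where

  projector : ℚ → Matrix n
  projector η x y = sum λ i → indicator (η ≟ θ i) * E i x y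

  projector-symmetric : ∀ η x y → projector η x y ≡ projector η y x
  projector-symmetric η x y = sum-cong-≗ λ i → cong (indicator (η ≟ θ i) *_) (E-symmetric i x y)

  projector-▹ : ∀ η w x → (projector η ▹ w) x ≡ sum λ i → indicator (η ≟ θ i) * (E i ▹ w) x
  projector-▹ η w x = begin
    (sum λ y → (sum λ i → indicator (η ≟ θ i) * E i x y) * w y)
      ≡⟨ sum-cong-≗ (λ y → *-distribʳ-sum (w y) λ i → indicator (η ≟ θ i) * E i x y) ⟩
    (sum λ y → sum λ i → indicator (η ≟ θ i) * E i x y * w y)
      ≡⟨ ∑-comm (λ y i → indicator (η ≟ θ i) * E i x y * w y) ⟩
    (sum λ i → sum λ y → indicator (η ≟ θ i) * E i x y * w y)
      ≡⟨ sum-cong-≗ (λ i → sum-cong-≗ λ y → *-assoc (indicator (η ≟ θ i)) (E i x y) (w y)) ⟩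
    (sum λ i → sum λ y → indicator (η ≟ θ i) * (E i x y * w y))
      ≡⟨ sum-cong-≗ (λ i → *-distribˡ-sum (indicator (η ≟ θ i)) λ y → E i x y * w y) ⟨
    (sum λ i → indicator (η ≟ θ i) * (E i ▹ w) x) ∎

  -- Transposing A Eᵢ = θᵢ Eᵢ gives Eᵢ A = θᵢ Eᵢ, and the two sides are then applied to an
  -- eigenvector `w`.
  E-adjoint : ∀ i η w → Eigenspace A η w → ∀ x → θ i * (E i ▹ w) x ≡ η * (E i ▹ w) x
  E-adjoint i η w Aw≗ηw x = begin
    θ i * (E i ▹ w) x
      ≡⟨ *-distribˡ-sum (θ i) (λ y → E i x y * w y) ⟩
    (sum λ y → θ i * (E i x y * w y))
      ≡⟨ sum-cong-≗ (λ y → *-assoc (θ i) (E i x y) (w y)) ⟨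
    (sum λ y → θ i * E i x y * w y)
      ≡⟨ sum-cong-≗ (λ y → cong (_* w y) (column y)) ⟩
    ((λ u y → (E i ▹ λ z → A z y) u) ▹ w) x
      ≡⟨ ▹-assoc (E i) A w x ⟨
    (E i ▹ A ▹ w) x
      ≡⟨ ▹-cong (E i) (λ y → trans (Aw≗ηw y) (*-comm η (w y))) x ⟩
    (E i ▹ λ y → w y * η) x
      ≡⟨ ▹-*ʳ (E i) w η x ⟩
    (E i ▹ w) x * η
      ≡⟨ *-comm ((E i ▹ w) x) η ⟩
    η * (E i ▹ w) x ∎
    where
    column : ∀ y → θ i * E i x y ≡ (E i ▹ λ z → A z y) x
    column y = begin
      θ i * E i x y              ≡⟨ cong (θ i *_) (E-symmetric i x y) ⟩
      θ i * E i y x              ≡⟨ E-eigen i x y ⟨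
      (sum λ z → A y z * E i z x) ≡⟨ sum-cong-≗ (λ z → trans (cong₂ _*_ (A-symmetric y z) (E-symmetric i z x)) (*-comm (A z y) (E i x z))) ⟩
      (sum λ z → E i x z * A z y) ∎

  -- By the symmetry of A, θᵢ (Eᵢ w) = η (Eᵢ w), so only the Eᵢ with θᵢ = η do not kill w.
  projector-fixes : ∀ η w → Eigenspace A η w → Fixed (projector η) w
  projector-fixes η w Aw≗ηw x = begin
    (projector η ▹ w) x                          ≡⟨ projector-▹ η w x ⟩
    (sum λ i → indicator (η ≟ θ i) * (E i ▹ w) x) ≡⟨ sum-cong-≗ component ⟩
    (sum λ i → (E i ▹ w) x)                      ≡⟨ ∑-comm (λ i y → E i x y * w y) ⟩
    (sum λ y → sum λ i → E i x y * w y)          ≡⟨ sum-cong-≗ (λ y → *-distribʳ-sum (w y) λ i → E i x y) ⟨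
    ((λ u y → sum λ i → E i u y) ▹ w) x          ≡⟨ ▹-congˡ E-complete w x ⟩
    (δ ▹ w) x                                    ≡⟨ δ-▹ w x ⟩
    w x                                          ∎
    where
    component : ∀ i → indicator (η ≟ θ i) * (E i ▹ w) x ≡ (E i ▹ w) x
    component i with η ≟ θ i
    ... | yes _    = *-identityˡ ((E i ▹ w) x)
    ... | no  η≢θi = trans (*-zeroˡ ((E i ▹ w) x)) (sym (x*y≡0⇒y≡0 (η≢θi ∘ p-q≡0⇒p≡q) (begin
      (η - θ i) * (E i ▹ w) x                 ≡⟨ ring η (θ i) ((E i ▹ w) x) ⟩
      η * (E i ▹ w) x - θ i * (E i ▹ w) x     ≡⟨ cong (λ h → η * (E i ▹ w) x - h) (E-adjoint i η w Aw≗ηw x) ⟩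
      η * (E i ▹ w) x - η * (E i ▹ w) x       ≡⟨ +-inverseʳ (η * (E i ▹ w) x) ⟩
      0ℚ ∎)))
      where
      ring : ∀ a b c → (a - b) * c ≡ a * c - b * c
      ring = solve-∀ ℚ-ring

  projector-eigen : ∀ η z → Eigenspace A η λ y → projector η y z
  projector-eigen η z x = begin
    (A ▹ λ y → sum λ i → indicator (η ≟ θ i) * E i y z) x
      ≡⟨ ▹-sum A (λ i y → indicator (η ≟ θ i) * E i y z) x ⟩
    (sum λ i → (A ▹ λ y → indicator (η ≟ θ i) * E i y z) x)
      ≡⟨ sum-cong-≗ component ⟩
    (sum λ i → η * (indicator (η ≟ θ i) * E i x z))
      ≡⟨ *-distribˡ-sum η (λ i → indicator (η ≟ θ i) * E i x z) ⟨
    η * projector η x z ∎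
    where
    component : ∀ i → (A ▹ λ y → indicator (η ≟ θ i) * E i y z) x ≡ η * (indicator (η ≟ θ i) * E i x z)
    component i = begin
      (A ▹ λ y → indicator (η ≟ θ i) * E i y z) x
        ≡⟨ ▹-cong A (λ y → *-comm (indicator (η ≟ θ i)) (E i y z)) x ⟩
      (A ▹ λ y → E i y z * indicator (η ≟ θ i)) x
        ≡⟨ ▹-*ʳ A (λ y → E i y z) (indicator (η ≟ θ i)) x ⟩
      (A ▹ λ y → E i y z) x * indicator (η ≟ θ i)
        ≡⟨ cong (_* indicator (η ≟ θ i)) (E-eigen i z x) ⟩
      θ i * E i x z * indicator (η ≟ θ i)
        ≡⟨ scalar ⟩
      η * (indicator (η ≟ θ i) * E i x z) ∎
      where
      scalar : θ i * E i x z * indicator (η ≟ θ i) ≡ η * (indicator (η ≟ θ i) * E i x z)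
      scalar with η ≟ θ i
      ... | yes refl = ring η (E i x z)
        where
        ring : ∀ a b → a * b * 1ℚ ≡ a * (1ℚ * b)
        ring = solve-∀ ℚ-ring
      ... | no _ = ring (θ i) η (E i x z)
        where
        ring : ∀ a c b → a * b * 0ℚ ≡ c * (0ℚ * b)
        ring = solve-∀ ℚ-ring

  -- Idempotence combines two facts: the columns of `projector η` lie in the eigenspace of `η`, and
  -- `projector η` fixes every vector of that eigenspace.
  projector-projection : ∀ η → IsProjection (projector η)
  projector-projection η = record
    { symmetric  = projector-symmetric η
    ; idempotent = λ z → projector-fixes η (λ y → projector η y z) (projector-eigen η z)
    }

  fixed⇒eigen : ∀ η w → Fixed (projector η) w → Eigenspace A η w
  fixed⇒eigen η w Pw≗w x = begin
    (A ▹ w) x                                           ≡⟨ ▹-cong A Pw≗w x ⟨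
    (A ▹ projector η ▹ w) x                             ≡⟨ ▹-assoc A (projector η) w x ⟩
    ((λ u z → (A ▹ λ y → projector η y z) u) ▹ w) x     ≡⟨ ▹-congˡ (λ u z → projector-eigen η z u) w x ⟩
    (sum λ y → η * projector η x y * w y)               ≡⟨ sum-cong-≗ (λ y → *-assoc η (projector η x y) (w y)) ⟩
    (sum λ y → η * (projector η x y * w y))             ≡⟨ *-distribˡ-sum η (λ y → projector η x y * w y) ⟨
    η * (projector η ▹ w) x                             ≡⟨ cong (η *_) (Pw≗w x) ⟩
    η * w x                                             ∎

  trace-projector : ∀ η → trace (projector η) ≡ sum λ i → indicator (η ≟ θ i) * trace (E i)
  trace-projector η = trans (∑-comm λ x i → indicator (η ≟ θ i) * E i x x)
    (sum-cong-≗ λ i → sym (*-distribˡ-sum (indicator (η ≟ θ i)) λ x → E i x x))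

  eigenspace-dimension : ∀ η → ∃ λ m →
    fromℕ m ≡ (sum λ i → indicator (η ≟ θ i) * trace (E i)) × HasDimension (Eigenspace A η) m
  eigenspace-dimension η with projection-dimension (allFin n) (projector-projection η) (λ y y∉ → contradiction (∈-allFin y) y∉)
  ... | m , m≡trace , u , basis = m , trans m≡trace (trace-projector η) , u , record
    { inside      = λ k → fixed⇒eigen η (u k) (IsBasis.inside basis k)
    ; independent = IsBasis.independent basis
    ; spanning    = λ w Aw≗ηw → IsBasis.spanning basis w (projector-fixes η w Aw≗ηw)
    }

eigenspace-cong : {A A′ : Matrix n} → (∀ x y → A x y ≡ A′ x y) → ∀ {η} →
                  HasDimension (Eigenspace A η) m → HasDimension (Eigenspace A′ η) m
eigenspace-cong A≗A′ (u , basis) = u , record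
  { inside      = λ k x → trans (sym (▹-congˡ A≗A′ (u k) x)) (IsBasis.inside basis k x)
  ; independent = IsBasis.independent basis
  ; spanning    = λ w A′w≗ηw → IsBasis.spanning basis w λ x → trans (▹-congˡ A≗A′ w x) (A′w≗ηw x)
  }

spectrum₄ : (k θ₁ θ₂ θ₃ : ℚ) (f₁ f₂ f₃ : ℕ) → List ℚ
spectrum₄ k θ₁ θ₂ θ₃ f₁ f₂ f₃ = [ k ]^ 1 ++ [ θ₁ ]^ f₁ ++ [ θ₂ ]^ f₂ ++ [ θ₃ ]^ f₃

fromℕ-length : ∀ k θ₁ θ₂ θ₃ f₁ f₂ f₃ →
  fromℕ (length (spectrum₄ k θ₁ θ₂ θ₃ f₁ f₂ f₃)) ≡ 1ℚ + (fromℕ f₁ + (fromℕ f₂ + fromℕ f₃))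
fromℕ-length k θ₁ θ₂ θ₃ f₁ f₂ f₃ = trans (cong fromℕ lengths) (trans (fromℕ-+ 1 (f₁ ℕ.+ (f₂ ℕ.+ f₃)))
  (cong (1ℚ +_) (trans (fromℕ-+ f₁ (f₂ ℕ.+ f₃)) (cong (fromℕ f₁ +_) (fromℕ-+ f₂ f₃)))))
  where
  lengths : length (spectrum₄ k θ₁ θ₂ θ₃ f₁ f₂ f₃) ≡ 1 ℕ.+ (f₁ ℕ.+ (f₂ ℕ.+ f₃))
  lengths = cong suc (trans (length-++ ([ θ₁ ]^ f₁)) (cong₂ ℕ._+_ (length-replicate f₁)
    (trans (length-++ ([ θ₂ ]^ f₂)) (cong₂ ℕ._+_ (length-replicate f₂) (length-replicate f₃)))))

occurrences-++ : ∀ η xs ys → occurrences η (xs ++ ys) ≡ occurrences η xs ℕ.+ occurrences η ys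
occurrences-++ η xs ys = trans (cong length (filter-++ (η ≟_) xs ys)) (length-++ (filter (η ≟_) xs))

fromℕ-occurrences-^ : ∀ η θ m → fromℕ (occurrences η ([ θ ]^ m)) ≡ indicator (η ≟ θ) * fromℕ m
fromℕ-occurrences-^ η θ m = by-cases (η ≟ θ)
  where
  by-cases : (d : Dec (η ≡ θ)) → fromℕ (occurrences η ([ θ ]^ m)) ≡ indicator d * fromℕ m
  by-cases (yes η≡θ) = trans
    (cong fromℕ (trans (cong length (filter-all (η ≟_) (All.replicate⁺ m η≡θ))) (length-replicate m)))
    (sym (*-identityˡ (fromℕ m)))
  by-cases (no η≢θ) = trans
    (cong (fromℕ ∘ length) (filter-none (η ≟_) (All.replicate⁺ m η≢θ)))
    (sym (*-zeroˡ (fromℕ m)))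

-- The dimension of an eigenspace is computed as the same sum weighted by indicators, so the two can
-- be compared without asking which of the four values coincide.
fromℕ-occurrences : ∀ k θ₁ θ₂ θ₃ f₁ f₂ f₃ η →
  fromℕ (occurrences η (spectrum₄ k θ₁ θ₂ θ₃ f₁ f₂ f₃)) ≡
  indicator (η ≟ k) * 1ℚ + (indicator (η ≟ θ₁) * fromℕ f₁ + (indicator (η ≟ θ₂) * fromℕ f₂ + indicator (η ≟ θ₃) * fromℕ f₃))
fromℕ-occurrences k θ₁ θ₂ θ₃ f₁ f₂ f₃ η =
  step k 1 ([ θ₁ ]^ f₁ ++ [ θ₂ ]^ f₂ ++ [ θ₃ ]^ f₃)
    (step θ₁ f₁ ([ θ₂ ]^ f₂ ++ [ θ₃ ]^ f₃) (step θ₂ f₂ ([ θ₃ ]^ f₃) (fromℕ-occurrences-^ η θ₃ f₃)))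
  where
  step : ∀ θ f Λ {a} → fromℕ (occurrences η Λ) ≡ a →
         fromℕ (occurrences η ([ θ ]^ f ++ Λ)) ≡ indicator (η ≟ θ) * fromℕ f + a
  step θ f Λ eq = trans (cong fromℕ (occurrences-++ η ([ θ ]^ f) Λ))
    (trans (fromℕ-+ (occurrences η ([ θ ]^ f)) (occurrences η Λ)) (cong₂ _+_ (fromℕ-occurrences-^ η θ f) eq))

-- The algebra spanned by the Gram matrices of the two incidence matrices

gram : (Fin n → Fin m → ℚ) → Matrix n
gram M x y = sum λ p → M x p * M y p

gram-symmetric : (M : Fin n → Fin m → ℚ) → ∀ x y → gram M x y ≡ gram M y x
gram-symmetric M x y = sum-cong-≗ λ p → *-comm (M x p) (M y p)

gram-▹ : (M : Fin n → Fin m → ℚ) (w : Vector ℚ n) → gram M ▹ w ≗ M ▹ (λ p y → M y p) ▹ w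
gram-▹ M w x = sym (▹-assoc M (λ p y → M y p) w x)

-- The product M Mᵀ M′ M′ᵀ is bracketed around MᵀM′, the factor that the axioms of the design
-- determine.
gram-gram : (M : Fin n → Fin m → ℚ) (M′ : Fin n → Fin k → ℚ) → ∀ z →
            gram M ▹ (λ y → gram M′ y z) ≗ M ▹ (λ p s → sum λ y → M y p * M′ y s) ▹ M′ z
gram-gram M M′ z x = trans (gram-▹ M (λ y → gram M′ y z) x) (▹-cong M (▹-assoc (λ p y → M y p) M′ (M′ z)) x)

-- `T` is the block size. `NᵀN` expresses the design property, `NᵀC` that a part covers each point
-- once, and `CᵀC` that the parts are disjoint and equally large.
record ResolvableIncidence {v ℓ b : ℕ} (N : Fin b → Fin v → ℚ) (C : Fin b → Fin ℓ → ℚ) (T r q : ℚ) : Set where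
  field
    NᵀN : ∀ p s → (sum λ j → N j p * N j s) ≡ 1ℚ + (r - 1ℚ) * δ p s
    NᵀC : ∀ p i → (sum λ j → N j p * C j i) ≡ 1ℚ
    CᵀC : ∀ i h → (sum λ j → C j i * C j h) ≡ q * δ i h
    N-row    : ∀ j → sum (N j) ≡ T
    C-row    : ∀ j → sum (C j) ≡ 1ℚ
    N-column : ∀ p → (sum λ j → N j p) ≡ r
    C-column : ∀ i → (sum λ j → C j i) ≡ q
    N-diagonal : ∀ j → gram N j j ≡ T
    C-diagonal : ∀ j → gram C j j ≡ 1ℚ

module IncidenceAlgebra {v ℓ b : ℕ} {N : Fin b → Fin v → ℚ} {C : Fin b → Fin ℓ → ℚ} {T r q : ℚ}
                        (incidence : ResolvableIncidence N C T r q) where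
  open ResolvableIncidence incidence

  K S : Matrix b
  K = gram N
  S = gram C

  K-1 : ∀ x → (K ▹ λ _ → 1ℚ) x ≡ T * r
  K-1 x = begin
    (K ▹ λ _ → 1ℚ) x                      ≡⟨ gram-▹ N (λ _ → 1ℚ) x ⟩
    (N ▹ (λ p y → N y p) ▹ λ _ → 1ℚ) x    ≡⟨ ▹-cong N (λ p → trans (▹-constant (λ p y → N y p) 1ℚ r p (N-column p)) (*-identityʳ r)) x ⟩
    (N ▹ λ _ → r) x                       ≡⟨ ▹-constant N r T x (N-row x) ⟩
    T * r                                 ∎

  S-1 : ∀ x → (S ▹ λ _ → 1ℚ) x ≡ q
  S-1 x = begin
    (S ▹ λ _ → 1ℚ) x                      ≡⟨ gram-▹ C (λ _ → 1ℚ) x ⟩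
    (C ▹ (λ p y → C y p) ▹ λ _ → 1ℚ) x    ≡⟨ ▹-cong C (λ p → trans (▹-constant (λ p y → C y p) 1ℚ q p (C-column p)) (*-identityʳ q)) x ⟩
    (C ▹ λ _ → q) x                       ≡⟨ ▹-constant C q 1ℚ x (C-row x) ⟩
    1ℚ * q                                ≡⟨ *-identityˡ q ⟩
    q                                     ∎

  -- This is N ((r - 1) I + J) Nᵀ, and N J Nᵀ has all entries T² because the rows of `N` sum to `T`.
  K-K : ∀ x z → (K ▹ λ y → K y z) x ≡ T * T + (r - 1ℚ) * K x z
  K-K x z = begin
    (K ▹ λ y → K y z) x
      ≡⟨ gram-gram N N z x ⟩
    (N ▹ (λ p s → sum λ y → N y p * N y s) ▹ N z) x
      ≡⟨ ▹-cong N inner x ⟩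
    (N ▹ λ p → T + N z p * (r - 1ℚ)) x
      ≡⟨ ▹-+ N (λ _ → T) (λ p → N z p * (r - 1ℚ)) x ⟩
    (N ▹ λ _ → T) x + (N ▹ λ p → N z p * (r - 1ℚ)) x
      ≡⟨ cong₂ _+_ (▹-constant N T T x (N-row x)) (▹-*ʳ N (N z) (r - 1ℚ) x) ⟩
    T * T + K x z * (r - 1ℚ)
      ≡⟨ cong (T * T +_) (*-comm (K x z) (r - 1ℚ)) ⟩
    T * T + (r - 1ℚ) * K x z ∎
    where
    ring : ∀ r d n → (1ℚ + (r - 1ℚ) * d) * n ≡ n + (r - 1ℚ) * (d * n)
    ring = solve-∀ ℚ-ring
    inner : ∀ p → ((λ p s → sum λ y → N y p * N y s) ▹ N z) p ≡ T + N z p * (r - 1ℚ)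
    inner p = begin
      ((λ p s → sum λ y → N y p * N y s) ▹ N z) p
        ≡⟨ sum-cong-≗ (λ s → trans (cong (_* N z s) (NᵀN p s)) (ring r (δ p s) (N z s))) ⟩
      (sum λ s → N z s + (r - 1ℚ) * (δ p s * N z s))
        ≡⟨ ∑-distrib-+ (N z) (λ s → (r - 1ℚ) * (δ p s * N z s)) ⟩
      sum (N z) + (sum λ s → (r - 1ℚ) * (δ p s * N z s))
        ≡⟨ cong₂ _+_ (N-row z) (sym (*-distribˡ-sum (r - 1ℚ) λ s → δ p s * N z s)) ⟩
      T + (r - 1ℚ) * (δ ▹ N z) p
        ≡⟨ cong (T +_) (trans (cong ((r - 1ℚ) *_) (δ-▹ (N z) p)) (*-comm (r - 1ℚ) (N z p))) ⟩
      T + N z p * (r - 1ℚ) ∎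

  -- N (NᵀC) Cᵀ = N J Cᵀ is constant: a row sum of `N` times a row sum of `C`.
  K-S : ∀ x z → (K ▹ λ y → S y z) x ≡ T
  K-S x z = begin
    (K ▹ λ y → S y z) x                                ≡⟨ gram-gram N C z x ⟩
    (N ▹ (λ p s → sum λ y → N y p * C y s) ▹ C z) x    ≡⟨ ▹-cong N inner x ⟩
    (N ▹ λ _ → 1ℚ) x                                   ≡⟨ ▹-constant N 1ℚ T x (N-row x) ⟩
    T * 1ℚ                                             ≡⟨ *-identityʳ T ⟩
    T                                                  ∎
    where
    inner : ∀ p → ((λ p s → sum λ y → N y p * C y s) ▹ C z) p ≡ 1ℚ
    inner p = trans (sum-cong-≗ λ s → trans (cong (_* C z s) (NᵀC p s)) (*-identityˡ (C z s))) (C-row z)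

  S-K : ∀ x z → (S ▹ λ y → K y z) x ≡ T
  S-K x z = begin
    (S ▹ λ y → K y z) x                                ≡⟨ gram-gram C N z x ⟩
    (C ▹ (λ i s → sum λ y → C y i * N y s) ▹ N z) x    ≡⟨ ▹-cong C inner x ⟩
    (C ▹ λ _ → T) x                                    ≡⟨ ▹-constant C T 1ℚ x (C-row x) ⟩
    1ℚ * T                                             ≡⟨ *-identityˡ T ⟩
    T                                                  ∎
    where
    inner : ∀ i → ((λ i s → sum λ y → C y i * N y s) ▹ N z) i ≡ T
    inner i = trans (sum-cong-≗ λ s → trans
      (cong (_* N z s) (trans (sum-cong-≗ λ y → *-comm (C y i) (N y s)) (NᵀC s i)))
      (*-identityˡ (N z s))) (N-row z)

  S-S : ∀ x z → (S ▹ λ y → S y z) x ≡ q * S x z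
  S-S x z = begin
    (S ▹ λ y → S y z) x                                ≡⟨ gram-gram C C z x ⟩
    (C ▹ (λ i h → sum λ y → C y i * C y h) ▹ C z) x    ≡⟨ ▹-cong C inner x ⟩
    (C ▹ λ i → C z i * q) x                            ≡⟨ ▹-*ʳ C (C z) q x ⟩
    S x z * q                                          ≡⟨ *-comm (S x z) q ⟩
    q * S x z                                          ∎
    where
    inner : ∀ i → ((λ i h → sum λ y → C y i * C y h) ▹ C z) i ≡ C z i * q
    inner i = begin
      ((λ i h → sum λ y → C y i * C y h) ▹ C z) i   ≡⟨ sum-cong-≗ (λ h → trans (cong (_* C z h) (CᵀC i h)) (*-assoc q (δ i h) (C z h))) ⟩
      (sum λ h → q * (δ i h * C z h))               ≡⟨ *-distribˡ-sum q (λ h → δ i h * C z h) ⟨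
      q * (δ ▹ C z) i                               ≡⟨ cong (q *_) (δ-▹ (C z) i) ⟩
      q * C z i                                     ≡⟨ *-comm q (C z i) ⟩
      C z i * q                                     ∎

  -- The coefficients belong to K, S, I and J in this order; J is the all-one matrix and contributes
  -- the constant `f`.
  combination : ℚ → ℚ → ℚ → ℚ → Matrix b
  combination a c e f x y = K x y * a + (S x y * c + (δ x y * e + f))

  combination-symmetric : ∀ a c e f x y → combination a c e f x y ≡ combination a c e f y x
  combination-symmetric a c e f x y = cong₂ _+_ (cong (_* a) (gram-symmetric N x y))
    (cong₂ _+_ (cong (_* c) (gram-symmetric C x y)) (cong (λ d → d * e + f) (δ-symmetric x y)))

  ▹-combination : (M : Matrix b) → ∀ a c e f z x → (M ▹ λ y → combination a c e f y z) x ≡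
    (M ▹ λ y → K y z) x * a + ((M ▹ λ y → S y z) x * c + (M x z * e + (M ▹ λ _ → 1ℚ) x * f))
  ▹-combination M a c e f z x = trans
    (▹-+ M (λ y → K y z * a) (λ y → S y z * c + (δ y z * e + f)) x)
    (cong₂ _+_ (▹-*ʳ M (λ y → K y z) a x) (trans
      (▹-+ M (λ y → S y z * c) (λ y → δ y z * e + f) x)
      (cong₂ _+_ (▹-*ʳ M (λ y → S y z) c x) (trans
        (▹-+ M (λ y → δ y z * e) (λ _ → f) x)
        (cong₂ _+_
          (trans (▹-*ʳ M (λ y → δ y z) e x) (cong (_* e) M-δ))
          (trans (▹-cong M (λ _ → sym (*-identityˡ f)) x) (▹-*ʳ M (λ _ → 1ℚ) f x)))))))
    where
    M-δ : (M ▹ λ y → δ y z) x ≡ M x z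
    M-δ = begin
      (M ▹ λ y → δ y z) x   ≡⟨ sum-cong-≗ (λ y → trans (*-comm (M x y) (δ y z)) (cong (_* M x y) (δ-symmetric y z))) ⟩
      (δ ▹ M x) z           ≡⟨ δ-▹ (M x) z ⟩
      M x z                 ∎

  -- The diagonals of `K` and `S` are T and 1, so subtracting (T + 1) I leaves a zero diagonal.
  A : Matrix b
  A = combination 1ℚ 1ℚ (- T - 1ℚ) 0ℚ

  A-▹ : ∀ w x → (A ▹ w) x ≡ (K ▹ w) x + ((S ▹ w) x + (- T - 1ℚ) * w x)
  A-▹ w x = begin
    (sum λ y → (K x y * 1ℚ + (S x y * 1ℚ + (δ x y * (- T - 1ℚ) + 0ℚ))) * w y)
      ≡⟨ sum-cong-≗ (λ y → ring (K x y) (S x y) (δ x y) T (w y)) ⟩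
    (sum λ y → K x y * w y + (S x y * w y + (- T - 1ℚ) * (δ x y * w y)))
      ≡⟨ ∑-distrib-+ (λ y → K x y * w y) (λ y → S x y * w y + (- T - 1ℚ) * (δ x y * w y)) ⟩
    (K ▹ w) x + (sum λ y → S x y * w y + (- T - 1ℚ) * (δ x y * w y))
      ≡⟨ cong ((K ▹ w) x +_) (∑-distrib-+ (λ y → S x y * w y) (λ y → (- T - 1ℚ) * (δ x y * w y))) ⟩
    (K ▹ w) x + ((S ▹ w) x + (sum λ y → (- T - 1ℚ) * (δ x y * w y)))
      ≡⟨ cong (λ h → (K ▹ w) x + ((S ▹ w) x + h)) (*-distribˡ-sum (- T - 1ℚ) (λ y → δ x y * w y)) ⟨
    (K ▹ w) x + ((S ▹ w) x + (- T - 1ℚ) * (δ ▹ w) x)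
      ≡⟨ cong (λ h → (K ▹ w) x + ((S ▹ w) x + (- T - 1ℚ) * h)) (δ-▹ w x) ⟩
    (K ▹ w) x + ((S ▹ w) x + (- T - 1ℚ) * w x) ∎
    where
    ring : ∀ k s d T w → (k * 1ℚ + (s * 1ℚ + (d * (- T - 1ℚ) + 0ℚ))) * w ≡ k * w + (s * w + (- T - 1ℚ) * (d * w))
    ring = solve-∀ ℚ-ring

  -- Left multiplication by `A` acts on the coefficients by a 4 × 4 matrix, triangular in the order
  -- I, K, S, J, whose diagonal already shows the four eigenvalues. Both A² and A Eᵢ are read off
  -- from it.
  A-combination : ∀ a c e f z x → (A ▹ λ y → combination a c e f y z) x ≡
    combination ((r - T - 1ℚ - 1ℚ) * a + e) ((q - T - 1ℚ) * c + e) ((- T - 1ℚ) * e)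
                ((T * T + T) * a + T * c + (T * r + q - T - 1ℚ) * f) x z
  A-combination a c e f z x = begin
    (A ▹ w) x
      ≡⟨ A-▹ w x ⟩
    (K ▹ w) x + ((S ▹ w) x + (- T - 1ℚ) * w x)
      ≡⟨ cong₂ (λ g h → g + (h + (- T - 1ℚ) * w x)) Kw Sw ⟩
    _ ≡⟨ ring (K x z) (S x z) (δ x z) T r q a c e f ⟩
    _ ∎
    where
    w : Vector ℚ b
    w y = combination a c e f y z
    Kw : (K ▹ w) x ≡ (T * T + (r - 1ℚ) * K x z) * a + (T * c + (K x z * e + T * r * f))
    Kw = trans (▹-combination K a c e f z x)
      (cong₂ _+_ (cong (_* a) (K-K x z)) (cong₂ _+_ (cong (_* c) (K-S x z)) (cong (λ h → K x z * e + h * f) (K-1 x))))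
    Sw : (S ▹ w) x ≡ T * a + (q * S x z * c + (S x z * e + q * f))
    Sw = trans (▹-combination S a c e f z x)
      (cong₂ _+_ (cong (_* a) (S-K x z)) (cong₂ _+_ (cong (_* c) (S-S x z)) (cong (λ h → S x z * e + h * f) (S-1 x))))
    ring : ∀ k s d T r q a c e f →
      ((T * T + (r - 1ℚ) * k) * a + (T * c + (k * e + T * r * f))) +
      ((T * a + (q * s * c + (s * e + q * f))) + (- T - 1ℚ) * (k * a + (s * c + (d * e + f)))) ≡
      k * ((r - T - 1ℚ - 1ℚ) * a + e) + (s * ((q - T - 1ℚ) * c + e) +
      (d * ((- T - 1ℚ) * e) + ((T * T + T) * a + T * c + (T * r + q - T - 1ℚ) * f)))
    ring = solve-∀ ℚ-ring

  trace-combination : ∀ a c e f → trace (combination a c e f) ≡ fromℕ b * (T * a + c + e + f)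
  trace-combination a c e f = trans (sum-cong-≗ diagonal) (sum-const b (T * a + c + e + f))
    where
    diagonal : ∀ x → combination a c e f x x ≡ T * a + c + e + f
    diagonal x = trans
      (cong₂ _+_ (cong (_* a) (N-diagonal x)) (cong₂ (λ g h → g * c + (h * e + f)) (C-diagonal x) (indicator-yes (x Fin.≟ x) refl)))
      (ring T a c e f)
      where
      ring : ∀ T a c e f → T * a + (1ℚ * c + (1ℚ * e + f)) ≡ T * a + c + e + f
      ring = solve-∀ ℚ-ring

-- The reciprocals enter as variables with polynomial equations. All spectral identities then follow
-- from `γrq≡1`, `β[r-1]≡1` and the replication identity `r[T-1]≡qT-1`, with explicit polynomial
-- coefficients.
module IncidenceSpectrum {v ℓ b : ℕ} {N : Fin b → Fin v → ℚ} {C : Fin b → Fin ℓ → ℚ} {T r q : ℚ}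
                         (incidence : ResolvableIncidence N C T r q)
                         (γ β : ℚ) (γrq≡1 : γ * (r * q) ≡ 1ℚ) (β[r-1]≡1 : β * (r - 1ℚ) ≡ 1ℚ)
                         (r[T-1]≡qT-1 : r * (T - 1ℚ) ≡ q * T - 1ℚ) (b≡rq : fromℕ b ≡ r * q) where
  open IncidenceAlgebra incidence

  -- Since γ = 1/b, γ r = 1/q and β = 1/(r - 1), the columns of the table say E₀ = J/b,
  -- E₁ = S/q - J/b, E₂ = (K - (T/q) J)/(r - 1) and E₃ = I - E₀ - E₁ - E₂.
  θ coeffK coeffS coeffI coeffJ : Vector ℚ 4
  θ      = (T * r + q - T - 1ℚ) ◂ (q - T - 1ℚ) ◂ (r - T - 1ℚ - 1ℚ)   ◂ (- T - 1ℚ)        ◂ ⟨⟩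
  coeffK = 0ℚ                   ◂ 0ℚ           ◂ β                   ◂ - β               ◂ ⟨⟩
  coeffS = 0ℚ                   ◂ (γ * r)      ◂ 0ℚ                  ◂ - (γ * r)         ◂ ⟨⟩
  coeffI = 0ℚ                   ◂ 0ℚ           ◂ 0ℚ                  ◂ 1ℚ                ◂ ⟨⟩
  coeffJ = γ                    ◂ - γ          ◂ - (β * T * (γ * r)) ◂ (β * T * (γ * r)) ◂ ⟨⟩

  E : Fin 4 → Matrix b
  E i = combination (coeffK i) (coeffS i) (coeffI i) (coeffJ i)

  -- `eigenK`, `eigenS`, `eigenI` and `eigenJ` together say that the coefficients of Eᵢ form an
  -- eigenvector, for θᵢ, of the triangular matrix in `A-combination`.
  eigenK : ∀ i → (r - T - 1ℚ - 1ℚ) * coeffK i + coeffI i ≡ θ i * coeffK i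
  eigenK zero = ring T r q
    where
    ring : ∀ T r q → (r - T - 1ℚ - 1ℚ) * 0ℚ + 0ℚ ≡ (T * r + q - T - 1ℚ) * 0ℚ
    ring = solve-∀ ℚ-ring
  eigenK (suc zero) = ring T r q
    where
    ring : ∀ T r q → (r - T - 1ℚ - 1ℚ) * 0ℚ + 0ℚ ≡ (q - T - 1ℚ) * 0ℚ
    ring = solve-∀ ℚ-ring
  eigenK (suc (suc zero)) = +-identityʳ ((r - T - 1ℚ - 1ℚ) * β)
  eigenK (suc (suc (suc zero))) = by-relation (- 1ℚ) (ring T r β) β[r-1]≡1
    where
    ring : ∀ T r β → (r - T - 1ℚ - 1ℚ) * (- β) + 1ℚ - (- T - 1ℚ) * (- β) ≡ - 1ℚ * (β * (r - 1ℚ) - 1ℚ)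
    ring = solve-∀ ℚ-ring

  eigenS : ∀ i → (q - T - 1ℚ) * coeffS i + coeffI i ≡ θ i * coeffS i
  eigenS zero = ring T r q
    where
    ring : ∀ T r q → (q - T - 1ℚ) * 0ℚ + 0ℚ ≡ (T * r + q - T - 1ℚ) * 0ℚ
    ring = solve-∀ ℚ-ring
  eigenS (suc zero) = +-identityʳ ((q - T - 1ℚ) * (γ * r))
  eigenS (suc (suc zero)) = ring T r q
    where
    ring : ∀ T r q → (q - T - 1ℚ) * 0ℚ + 0ℚ ≡ (r - T - 1ℚ - 1ℚ) * 0ℚ
    ring = solve-∀ ℚ-ring
  eigenS (suc (suc (suc zero))) = by-relation (- 1ℚ) (ring T r q γ) γrq≡1
    where
    ring : ∀ T r q γ → (q - T - 1ℚ) * (- (γ * r)) + 1ℚ - (- T - 1ℚ) * (- (γ * r)) ≡ - 1ℚ * (γ * (r * q) - 1ℚ)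
    ring = solve-∀ ℚ-ring

  eigenI : ∀ i → (- T - 1ℚ) * coeffI i ≡ θ i * coeffI i
  eigenI zero                   = trans (*-zeroʳ (- T - 1ℚ)) (sym (*-zeroʳ (θ zero)))
  eigenI (suc zero)             = trans (*-zeroʳ (- T - 1ℚ)) (sym (*-zeroʳ (θ (suc zero))))
  eigenI (suc (suc zero))       = trans (*-zeroʳ (- T - 1ℚ)) (sym (*-zeroʳ (θ (suc (suc zero)))))
  eigenI (suc (suc (suc zero))) = refl

  eigenJ : ∀ i → (T * T + T) * coeffK i + T * coeffS i + (T * r + q - T - 1ℚ) * coeffJ i ≡ θ i * coeffJ i
  eigenJ zero = ring T r q γ
    where
    ring : ∀ T r q γ → (T * T + T) * 0ℚ + T * 0ℚ + (T * r + q - T - 1ℚ) * γ ≡ (T * r + q - T - 1ℚ) * γ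
    ring = solve-∀ ℚ-ring
  eigenJ (suc zero) = ring T r q γ
    where
    ring : ∀ T r q γ → (T * T + T) * 0ℚ + T * (γ * r) + (T * r + q - T - 1ℚ) * (- γ) ≡ (q - T - 1ℚ) * (- γ)
    ring = solve-∀ ℚ-ring
  eigenJ (suc (suc zero)) =
    -- The gap θ₀ - θ₂ = r (T - 1) + q + 1 equals q (T + 1) by the replication identity, and its
    -- factor q cancels against γ r.
    by-relations (- (β * T * (T + 1ℚ))) (- (β * T * (γ * r))) (ring T r q γ β) γrq≡1 r[T-1]≡qT-1
    where
    ring : ∀ T r q γ β →
      (T * T + T) * β + T * 0ℚ + (T * r + q - T - 1ℚ) * (- (β * T * (γ * r))) - (r - T - 1ℚ - 1ℚ) * (- (β * T * (γ * r))) ≡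
      - (β * T * (T + 1ℚ)) * (γ * (r * q) - 1ℚ) + - (β * T * (γ * r)) * (r * (T - 1ℚ) - (q * T - 1ℚ))
    ring = solve-∀ ℚ-ring
  eigenJ (suc (suc (suc zero))) =
    -- Here the gap is θ₀ - θ₃ = T r + q = q (T + 1) + (r - 1); the first summand cancels against γ
    -- r, the second against β.
    by-relations₃ (T * (T + 1ℚ) * β) (T * (γ * r)) (T * (γ * r) * β) (ring T r q γ β) γrq≡1 β[r-1]≡1 r[T-1]≡qT-1
    where
    ring : ∀ T r q γ β →
      (T * T + T) * (- β) + T * (- (γ * r)) + (T * r + q - T - 1ℚ) * (β * T * (γ * r)) - (- T - 1ℚ) * (β * T * (γ * r)) ≡
      T * (T + 1ℚ) * β * (γ * (r * q) - 1ℚ) + T * (γ * r) * (β * (r - 1ℚ) - 1ℚ) + T * (γ * r) * β * (r * (T - 1ℚ) - (q * T - 1ℚ))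
    ring = solve-∀ ℚ-ring

  E-eigen : ∀ i z → Eigenspace A (θ i) λ y → E i y z
  E-eigen i z x = trans (A-combination (coeffK i) (coeffS i) (coeffI i) (coeffJ i) z x) (trans
    (cong₂ _+_ (cong (K x z *_) (eigenK i)) (cong₂ _+_ (cong (S x z *_) (eigenS i)) (cong₂ (λ g h → δ x z * g + h) (eigenI i) (eigenJ i))))
    (ring (K x z) (S x z) (δ x z) (θ i) (coeffK i) (coeffS i) (coeffI i) (coeffJ i)))
    where
    ring : ∀ k s d t a c e f → k * (t * a) + (s * (t * c) + (d * (t * e) + t * f)) ≡ t * (k * a + (s * c + (d * e + f)))
    ring = solve-∀ ℚ-ring

  E-complete : ∀ x y → (sum λ i → E i x y) ≡ δ x y
  E-complete x y = ring (K x y) (S x y) (δ x y) γ β (γ * r) (β * T * (γ * r))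
    where
    ring : ∀ k s d γ β α h →
      (k * 0ℚ + (s * 0ℚ + (d * 0ℚ + γ))) + ((k * 0ℚ + (s * α + (d * 0ℚ + - γ))) +
      ((k * β + (s * 0ℚ + (d * 0ℚ + - h))) + ((k * (- β) + (s * (- α) + (d * 1ℚ + h))) + 0ℚ))) ≡ d
    ring = solve-∀ ℚ-ring

  -- The last entry is what the other three leave of b = r q.
  multiplicity : Vector ℚ 4
  multiplicity = 1ℚ ◂ (r - 1ℚ) ◂ (q * T - 1ℚ) ◂ (r * q - r - q * T + 1ℚ) ◂ ⟨⟩

  trace-E : ∀ i → trace (E i) ≡ multiplicity i
  trace-E i = trans (trace-combination (coeffK i) (coeffS i) (coeffI i) (coeffJ i))
    (trans (cong (_* (T * coeffK i + coeffS i + coeffI i + coeffJ i)) b≡rq) (rank i))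
    where
    rank : ∀ i → r * q * (T * coeffK i + coeffS i + coeffI i + coeffJ i) ≡ multiplicity i
    rank zero = by-relation 1ℚ (ring T r q γ) γrq≡1
      where
      ring : ∀ T r q γ → r * q * (T * 0ℚ + 0ℚ + 0ℚ + γ) - 1ℚ ≡ 1ℚ * (γ * (r * q) - 1ℚ)
      ring = solve-∀ ℚ-ring
    rank (suc zero) = by-relation (r - 1ℚ) (ring T r q γ) γrq≡1
      where
      ring : ∀ T r q γ → r * q * (T * 0ℚ + γ * r + 0ℚ + - γ) - (r - 1ℚ) ≡ (r - 1ℚ) * (γ * (r * q) - 1ℚ)
      ring = solve-∀ ℚ-ring
    rank (suc (suc zero)) =
      -- Since T (q - 1) = (r - 1) (T - 1), the trace β T r (q - 1) becomes r (T - 1) = q T - 1.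
      by-relations₃ (- (β * T * r)) (r * (T - 1ℚ)) (1ℚ - β * r) (ring T r q γ β) γrq≡1 β[r-1]≡1 r[T-1]≡qT-1
      where
      ring : ∀ T r q γ β → r * q * (T * β + 0ℚ + 0ℚ + - (β * T * (γ * r))) - (q * T - 1ℚ) ≡
        - (β * T * r) * (γ * (r * q) - 1ℚ) + r * (T - 1ℚ) * (β * (r - 1ℚ) - 1ℚ) + (1ℚ - β * r) * (r * (T - 1ℚ) - (q * T - 1ℚ))
      ring = solve-∀ ℚ-ring
    rank (suc (suc (suc zero))) =
      by-relations₃ (β * T * r - r) (- (r * (T - 1ℚ))) (β * r - 1ℚ) (ring T r q γ β) γrq≡1 β[r-1]≡1 r[T-1]≡qT-1
      where
      ring : ∀ T r q γ β → r * q * (T * (- β) + - (γ * r) + 1ℚ + β * T * (γ * r)) - (r * q - r - q * T + 1ℚ) ≡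
        (β * T * r - r) * (γ * (r * q) - 1ℚ) + - (r * (T - 1ℚ)) * (β * (r - 1ℚ) - 1ℚ) + (β * r - 1ℚ) * (r * (T - 1ℚ) - (q * T - 1ℚ))
      ring = solve-∀ ℚ-ring

  A-symmetric : ∀ x y → A x y ≡ A y x
  A-symmetric = combination-symmetric 1ℚ 1ℚ (- T - 1ℚ) 0ℚ

  eigenspace-dimension : ∀ η → ∃ λ m →
    fromℕ m ≡ (sum λ i → indicator (η ≟ θ i) * multiplicity i) × HasDimension (Eigenspace A η) m
  eigenspace-dimension η =
    proj₁ dimension , trans (proj₁ (proj₂ dimension)) (sum-cong-≗ λ i → cong (indicator (η ≟ θ i) *_) (trace-E i)) , proj₂ (proj₂ dimension)
    where
    dimension : ∃ λ m → fromℕ m ≡ (sum λ i → indicator (η ≟ θ i) * trace (E i)) × HasDimension (Eigenspace A η) m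
    dimension = SpectralResolution.eigenspace-dimension A-symmetric θ E
      (λ i → combination-symmetric (coeffK i) (coeffS i) (coeffI i) (coeffJ i)) E-eigen E-complete η

  A-1 : ∀ x → (sum λ y → A x y) ≡ T * r + q - T - 1ℚ
  A-1 x = begin
    (sum λ y → A x y)                        ≡⟨ sum-cong-≗ (λ y → *-identityʳ (A x y)) ⟨
    (A ▹ λ _ → 1ℚ) x                         ≡⟨ A-▹ (λ _ → 1ℚ) x ⟩
    (K ▹ λ _ → 1ℚ) x + ((S ▹ λ _ → 1ℚ) x + (- T - 1ℚ) * 1ℚ) ≡⟨ cong₂ (λ g h → g + (h + (- T - 1ℚ) * 1ℚ)) (K-1 x) (S-1 x) ⟩
    T * r + (q + (- T - 1ℚ) * 1ℚ)            ≡⟨ ring T r q ⟩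
    T * r + q - T - 1ℚ                       ∎
    where
    ring : ∀ T r q → T * r + (q + (- T - 1ℚ) * 1ℚ) ≡ T * r + q - T - 1ℚ
    ring = solve-∀ ℚ-ring

  -- At a non-adjacent pair `K`, `S` and `δ` vanish, and the constant T (T + 2) remains. The
  -- coefficients of `K` and `S` are the deviations at meeting and at parallel blocks.
  A-A : ∀ x z → (sum λ y → A x y * A y z) ≡
        K x z * (r - T - 1ℚ - 1ℚ + (- T - 1ℚ)) + (S x z * (q - T - 1ℚ + (- T - 1ℚ)) + (δ x z * ((- T - 1ℚ) * (- T - 1ℚ)) + T * (T + (1ℚ + 1ℚ))))
  A-A x z = trans (A-combination 1ℚ 1ℚ (- T - 1ℚ) 0ℚ z x) (ring (K x z) (S x z) (δ x z) T r q)
    where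
    ring : ∀ k s d T r q →
      k * ((r - T - 1ℚ - 1ℚ) * 1ℚ + (- T - 1ℚ)) + (s * ((q - T - 1ℚ) * 1ℚ + (- T - 1ℚ)) +
      (d * ((- T - 1ℚ) * (- T - 1ℚ)) + ((T * T + T) * 1ℚ + T * 1ℚ + (T * r + q - T - 1ℚ) * 0ℚ))) ≡
      k * (r - T - 1ℚ - 1ℚ + (- T - 1ℚ)) + (s * (q - T - 1ℚ + (- T - 1ℚ)) + (d * ((- T - 1ℚ) * (- T - 1ℚ)) + T * (T + (1ℚ + 1ℚ))))
    ring = solve-∀ ℚ-ring

-- Designs and their block graphs

fromℕ-∣∣ : (p : Subset n) → fromℕ ∣ p ∣ ≡ sum λ x → indicator (x ∈? p)
fromℕ-∣∣ []            = refl
fromℕ-∣∣ (inside  ∷ p) = trans (fromℕ-+ 1 ∣ p ∣) (cong (1ℚ +_) (fromℕ-∣∣ p))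
fromℕ-∣∣ (outside ∷ p) = trans (sym (+-identityˡ (fromℕ ∣ p ∣))) (cong (0ℚ +_) (fromℕ-∣∣ p))

indicator-∈-tabulate : {P : Fin n → Set} (P? : ∀ x → Dec (P x)) → ∀ x →
                       indicator (x ∈? tabulate λ y → does (P? y)) ≡ indicator (P? x)
indicator-∈-tabulate P? x with P? x in eq
... | yes _ = indicator-yes (x ∈? _) (lookup⇒[]= x _ (trans (lookup∘tabulate _ x) (cong does eq)))
... | no _  = indicator-no (x ∈? _) λ x∈ → case trans (sym ([]=⇒lookup x∈)) (trans (lookup∘tabulate _ x) (cong does eq)) of λ ()

indicator-∈-∩ : (p p′ : Subset n) → ∀ x → indicator (x ∈? p ∩ p′) ≡ indicator (x ∈? p) * indicator (x ∈? p′)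
indicator-∈-∩ p p′ x = trans (by-cases (x ∈? p) (x ∈? p′)) (indicator-× (x ∈? p) (x ∈? p′))
  where
  by-cases : (d : Dec (x ∈ p)) (d′ : Dec (x ∈ p′)) → indicator (x ∈? p ∩ p′) ≡ indicator (d ×-dec d′)
  by-cases (yes x∈p) (yes x∈p′) = indicator-yes (x ∈? p ∩ p′) (x∈p∩q⁺ (x∈p , x∈p′))
  by-cases (yes _)   (no x∉p′)  = indicator-no (x ∈? p ∩ p′) (x∉p′ ∘ proj₂ ∘ x∈p∩q⁻ p p′)
  by-cases (no x∉p)  _          = indicator-no (x ∈? p ∩ p′) (x∉p ∘ proj₁ ∘ x∈p∩q⁻ p p′)

missing-element : (p : Subset n) → ∣ p ∣ < n → ∃ λ x → ¬ (x ∈ p)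
missing-element {n} p ∣p∣<n = Fin.¬∀⟶∃¬ n (_∈ p) (_∈? p) λ all → ℕ.<⇒≢ ∣p∣<n (fromℕ-injective ∣ p ∣ n (begin
  fromℕ ∣ p ∣                        ≡⟨ fromℕ-∣∣ p ⟩
  (sum λ x → indicator (x ∈? p))     ≡⟨ sum-cong-≗ (λ x → indicator-yes (x ∈? p) (all x)) ⟩
  (sum {n} λ _ → 1ℚ)                 ≡⟨ sum-const n 1ℚ ⟩
  fromℕ n * 1ℚ                       ≡⟨ *-identityʳ (fromℕ n) ⟩
  fromℕ n                            ∎))

distinct-points : 1 < n → ∃₂ λ (x y : Fin n) → x ≢ y
distinct-points {suc (suc n)} _ = zero , suc zero , λ ()
distinct-points {suc zero} (ℕ.s≤s ())

module GraphCounting {n : ℕ} (G : Graph n) where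
  open Graph G

  indicator-neighbours : ∀ x y → indicator (y ∈? neighbours x) ≡ adjacency x y
  indicator-neighbours x = indicator-∈-tabulate (x ~?_)

  fromℕ-degree : ∀ x → fromℕ ∣ neighbours x ∣ ≡ sum (adjacency x)
  fromℕ-degree x = trans (fromℕ-∣∣ (neighbours x)) (sum-cong-≗ (indicator-neighbours x))

  adjacency-symmetric : ∀ x y → adjacency x y ≡ adjacency y x
  adjacency-symmetric x y with x ~? y
  ... | yes x~y = sym (indicator-yes (y ~? x) (~-sym x~y))
  ... | no  x≁y = sym (indicator-no (y ~? x) (x≁y ∘ ~-sym))

  fromℕ-commonNeighbours : ∀ x y → fromℕ (commonNeighbours x y) ≡ sum λ z → adjacency x z * adjacency z y
  fromℕ-commonNeighbours x y = trans (fromℕ-∣∣ (neighbours x ∩ neighbours y)) (sum-cong-≗ λ z →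
    trans (indicator-∈-∩ (neighbours x) (neighbours y) z)
      (cong₂ _*_ (indicator-neighbours x z) (trans (indicator-neighbours y z) (adjacency-symmetric y z))))

module ResolvableDesign {v t : ℕ} {D : Design v t} (R : Resolution D) where
  open Design D
  open Resolution R
  open Graph (blockGraph D R)
  private module Parts = IsPartition blocksPartition
  private module Points (i : Fin ℓ) = IsPartition (pointsPartition i)

  N : Fin b → Fin v → ℚ
  N j p = indicator (p ∈? block j)

  C : Fin b → Fin ℓ → ℚ
  C j i = indicator (j ∈? part i)

  part-unique : ∀ {j i h} → j ∈ part i → j ∈ part h → i ≡ h
  part-unique {j} j∈i j∈h with Parts.exactlyOne j
  ... | _ , _ , unique = trans (sym (unique (tt , j∈i))) (unique (tt , j∈h))

  parallel-disjoint : ∀ {i p j k} → j ∈ part i → k ∈ part i → p ∈ block j → p ∈ block k → j ≡ k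
  parallel-disjoint {i} {p} j∈i k∈i p∈j p∈k with Points.exactlyOne i p
  ... | _ , _ , unique = trans (sym (unique (j∈i , p∈j))) (unique (k∈i , p∈k))

  block-unique : ∀ {p s j k} → p ≢ s → p ∈ block j → s ∈ block j → p ∈ block k → s ∈ block k → j ≡ k
  block-unique p≢s p∈j s∈j p∈k s∈k with balanced p≢s
  ... | _ , _ , unique = trans (sym (unique (p∈j , s∈j))) (unique (p∈k , s∈k))

  N-row : ∀ j → sum (N j) ≡ fromℕ t
  N-row j = trans (sym (fromℕ-∣∣ (block j))) (cong fromℕ (blockSize j))

  C-row : ∀ j → sum (C j) ≡ 1ℚ
  C-row j with Parts.exactlyOne j
  ... | i , (_ , j∈i) , _ = sum-indicator-∃! (λ i → j ∈? part i) (i , j∈i , part-unique j∈i)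

  NᵀC : ∀ p i → (sum λ j → N j p * C j i) ≡ 1ℚ
  NᵀC p i with Points.exactlyOne i p
  ... | j , (j∈i , p∈j) , unique = sum-indicator-×-∃! (λ j → p ∈? block j) (λ j → j ∈? part i)
    (j , (p∈j , j∈i) , λ (p∈k , k∈i) → unique (k∈i , p∈k))

  -- Every part has exactly one block on `p`, so counting part by part identifies the replication
  -- number with `ℓ`.
  N-column : ∀ p → (sum λ j → N j p) ≡ fromℕ ℓ
  N-column p = begin
    (sum λ j → N j p)                   ≡⟨ sum-cong-≗ (λ j → trans (cong (N j p *_) (C-row j)) (*-identityʳ (N j p))) ⟨
    (sum λ j → N j p * sum (C j))       ≡⟨ sum-cong-≗ (λ j → *-distribˡ-sum (N j p) (C j)) ⟩
    (sum λ j → sum λ i → N j p * C j i) ≡⟨ ∑-comm (λ j i → N j p * C j i) ⟩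
    (sum λ i → sum λ j → N j p * C j i) ≡⟨ sum-cong-≗ (NᵀC p) ⟩
    (sum {ℓ} λ i → 1ℚ)                  ≡⟨ sum-const ℓ 1ℚ ⟩
    fromℕ ℓ * 1ℚ                        ≡⟨ *-identityʳ (fromℕ ℓ) ⟩
    fromℕ ℓ                             ∎

  C-column-* : ∀ i → (sum λ j → C j i) * fromℕ t ≡ fromℕ v
  C-column-* i = begin
    (sum λ j → C j i) * fromℕ t         ≡⟨ *-distribʳ-sum (fromℕ t) (λ j → C j i) ⟩
    (sum λ j → C j i * fromℕ t)         ≡⟨ sum-cong-≗ (λ j → cong (C j i *_) (N-row j)) ⟨
    (sum λ j → C j i * sum (N j))       ≡⟨ sum-cong-≗ (λ j → *-distribˡ-sum (C j i) (N j)) ⟩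
    (sum λ j → sum λ p → C j i * N j p) ≡⟨ ∑-comm (λ j p → C j i * N j p) ⟩
    (sum λ p → sum λ j → C j i * N j p) ≡⟨ sum-cong-≗ (λ p → trans (sum-cong-≗ λ j → *-comm (C j i) (N j p)) (NᵀC p i)) ⟩
    (sum {v} λ p → 1ℚ)                  ≡⟨ sum-const v 1ℚ ⟩
    fromℕ v * 1ℚ                        ≡⟨ *-identityʳ (fromℕ v) ⟩
    fromℕ v                             ∎

  NᵀN : ∀ p s → (sum λ j → N j p * N j s) ≡ 1ℚ + (fromℕ ℓ - 1ℚ) * δ p s
  NᵀN p s with p Fin.≟ s
  ... | yes refl = begin
    (sum λ j → N j p * N j p)   ≡⟨ sum-cong-≗ (λ j → indicator-square (p ∈? block j)) ⟩
    (sum λ j → N j p)           ≡⟨ N-column p ⟩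
    fromℕ ℓ                     ≡⟨ ring (fromℕ ℓ) ⟩
    1ℚ + (fromℕ ℓ - 1ℚ) * 1ℚ    ∎
    where
    ring : ∀ r → r ≡ 1ℚ + (r - 1ℚ) * 1ℚ
    ring = solve-∀ ℚ-ring
  ... | no p≢s = trans (sum-indicator-×-∃! (λ j → p ∈? block j) (λ j → s ∈? block j) (balanced p≢s)) (ring (fromℕ ℓ))
    where
    ring : ∀ r → 1ℚ ≡ 1ℚ + (r - 1ℚ) * 0ℚ
    ring = solve-∀ ℚ-ring

  CᵀC : ∀ {q} → (∀ i → (sum λ j → C j i) ≡ q) → ∀ i h → (sum λ j → C j i * C j h) ≡ q * δ i h
  CᵀC {q} C-column i h with i Fin.≟ h
  ... | yes refl = begin
    (sum λ j → C j i * C j i)   ≡⟨ sum-cong-≗ (λ j → indicator-square (j ∈? part i)) ⟩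
    (sum λ j → C j i)           ≡⟨ C-column i ⟩
    q                           ≡⟨ *-identityʳ q ⟨
    q * 1ℚ                      ∎
  ... | no i≢h = trans
    (sum-indicator-×-∅ (λ j → j ∈? part i) (λ j → j ∈? part h) λ j j∈i j∈h → i≢h (part-unique j∈i j∈h))
    (sym (*-zeroʳ q))

  N-diagonal : ∀ j → gram N j j ≡ fromℕ t
  N-diagonal j = trans (sum-cong-≗ λ p → indicator-square (p ∈? block j)) (N-row j)

  C-diagonal : ∀ j → gram C j j ≡ 1ℚ
  C-diagonal j = trans (sum-cong-≗ λ i → indicator-square (j ∈? part i)) (C-row j)

  incidence : ∀ {q} → (∀ i → (sum λ j → C j i) ≡ q) → ResolvableIncidence N C (fromℕ t) (fromℕ ℓ) q
  incidence C-column = record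
    { NᵀN = NᵀN ; NᵀC = NᵀC ; CᵀC = CᵀC C-column ; N-row = N-row ; C-row = C-row
    ; N-column = N-column ; C-column = C-column ; N-diagonal = N-diagonal ; C-diagonal = C-diagonal }

  fromℕ-b : ∀ {q} → (∀ i → (sum λ j → C j i) ≡ q) → fromℕ b ≡ fromℕ ℓ * q
  fromℕ-b {q} C-column = begin
    fromℕ b                    ≡⟨ *-identityʳ (fromℕ b) ⟨
    fromℕ b * 1ℚ               ≡⟨ sum-const b 1ℚ ⟨
    (sum {b} λ _ → 1ℚ)         ≡⟨ sum-cong-≗ C-row ⟨
    (sum λ j → sum λ i → C j i) ≡⟨ ∑-comm C ⟩
    (sum λ i → sum λ j → C j i) ≡⟨ sum-cong-≗ C-column ⟩
    (sum {ℓ} λ _ → q)          ≡⟨ sum-const ℓ q ⟩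
    fromℕ ℓ * q                ∎

  -- Double counting of the pairs of a block on `p` and a point of that block: each other point
  -- occurs once, `p` itself `ℓ` times.
  replication : Fin v → fromℕ ℓ * (fromℕ t - 1ℚ) ≡ fromℕ v - 1ℚ
  replication p = begin
    fromℕ ℓ * (fromℕ t - 1ℚ)       ≡⟨ ring (fromℕ ℓ) (fromℕ t) ⟩
    fromℕ ℓ * fromℕ t - fromℕ ℓ    ≡⟨ cong (_- fromℕ ℓ) double-count ⟩
    fromℕ v + (fromℕ ℓ - 1ℚ) - fromℕ ℓ ≡⟨ ring₂ (fromℕ v) (fromℕ ℓ) ⟩
    fromℕ v - 1ℚ                   ∎
    where
    ring : ∀ r t → r * (t - 1ℚ) ≡ r * t - r
    ring = solve-∀ ℚ-ring
    ring₂ : ∀ v r → v + (r - 1ℚ) - r ≡ v - 1ℚ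
    ring₂ = solve-∀ ℚ-ring
    double-count : fromℕ ℓ * fromℕ t ≡ fromℕ v + (fromℕ ℓ - 1ℚ)
    double-count = begin
      fromℕ ℓ * fromℕ t                        ≡⟨ cong (_* fromℕ t) (N-column p) ⟨
      (sum λ j → N j p) * fromℕ t              ≡⟨ *-distribʳ-sum (fromℕ t) (λ j → N j p) ⟩
      (sum λ j → N j p * fromℕ t)              ≡⟨ sum-cong-≗ (λ j → cong (N j p *_) (N-row j)) ⟨
      (sum λ j → N j p * sum (N j))            ≡⟨ sum-cong-≗ (λ j → *-distribˡ-sum (N j p) (N j)) ⟩
      (sum λ j → sum λ s → N j p * N j s)      ≡⟨ ∑-comm (λ j s → N j p * N j s) ⟩
      (sum λ s → sum λ j → N j p * N j s)      ≡⟨ sum-cong-≗ (NᵀN p) ⟩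
      (sum λ s → 1ℚ + (fromℕ ℓ - 1ℚ) * δ p s)  ≡⟨ ∑-distrib-+ (λ _ → 1ℚ) (λ s → (fromℕ ℓ - 1ℚ) * δ p s) ⟩
      (sum {v} λ _ → 1ℚ) + (sum λ s → (fromℕ ℓ - 1ℚ) * δ p s)
        ≡⟨ cong₂ _+_ (trans (sum-const v 1ℚ) (*-identityʳ (fromℕ v))) (sym (*-distribˡ-sum (fromℕ ℓ - 1ℚ) (δ p))) ⟩
      fromℕ v + (fromℕ ℓ - 1ℚ) * sum (δ p)
        ≡⟨ cong (λ h → fromℕ v + (fromℕ ℓ - 1ℚ) * h) (sum-indicator-∃! (λ s → p Fin.≟ s) (p , refl , λ p≡s → p≡s)) ⟩
      fromℕ v + (fromℕ ℓ - 1ℚ) * 1ℚ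
        ≡⟨ cong (fromℕ v +_) (*-identityʳ (fromℕ ℓ - 1ℚ)) ⟩
      fromℕ v + (fromℕ ℓ - 1ℚ)                 ∎

  -- Distinct blocks share at most one point, and distinct blocks of one part share none. So the two
  -- kinds of adjacency exclude each other, and K + S is a 0-1 matrix off the diagonal.
  gram-meeting : ∀ {j k p} → j ≢ k → p ∈ block j → p ∈ block k → gram N j k ≡ 1ℚ × gram C j k ≡ 0ℚ
  gram-meeting {j} {k} {p} j≢k p∈j p∈k =
    sum-indicator-×-∃! (λ s → s ∈? block j) (λ s → s ∈? block k) (p , (p∈j , p∈k) , unique) ,
    sum-indicator-×-∅ (λ i → j ∈? part i) (λ i → k ∈? part i) (λ i j∈i k∈i → j≢k (parallel-disjoint j∈i k∈i p∈j p∈k))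
    where
    unique : ∀ {s} → s ∈ block j × s ∈ block k → p ≡ s
    unique {s} (s∈j , s∈k) with p Fin.≟ s
    ... | yes p≡s = p≡s
    ... | no  p≢s = contradiction (block-unique p≢s p∈j s∈j p∈k s∈k) j≢k

  gram-parallel : ∀ {j k i} → j ≢ k → j ∈ part i → k ∈ part i → gram N j k ≡ 0ℚ × gram C j k ≡ 1ℚ
  gram-parallel {j} {k} {i} j≢k j∈i k∈i =
    sum-indicator-×-∅ (λ s → s ∈? block j) (λ s → s ∈? block k) (λ s s∈j s∈k → j≢k (parallel-disjoint j∈i k∈i s∈j s∈k)) ,
    sum-indicator-×-∃! (λ i → j ∈? part i) (λ i → k ∈? part i) (i , (j∈i , k∈i) , λ (j∈h , _) → part-unique j∈i j∈h)

  gram-nonadjacent : ∀ {j k} → j ≢ k → ¬ (j ~ k) → gram N j k ≡ 0ℚ × gram C j k ≡ 0ℚ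
  gram-nonadjacent {j} {k} j≢k j≁k =
    sum-indicator-×-∅ (λ s → s ∈? block j) (λ s → s ∈? block k)
      (λ s s∈j s∈k → j≁k (j≢k , inj₁ (s , x∈p∩q⁺ (s∈j , s∈k)))) ,
    sum-indicator-×-∅ (λ i → j ∈? part i) (λ i → k ∈? part i)
      (λ i j∈i k∈i → j≁k (j≢k , inj₂ (i , j∈i , k∈i)))

  adjacency-gram : ∀ j k → adjacency j k ≡ gram N j k * 1ℚ + (gram C j k * 1ℚ + (δ j k * (- fromℕ t - 1ℚ) + 0ℚ))
  adjacency-gram j k = by-cases (j Fin.≟ k) (j ~? k)
    where
    rhs : ℚ → ℚ → ℚ → ℚ
    rhs K S d = K * 1ℚ + (S * 1ℚ + (d * (- fromℕ t - 1ℚ) + 0ℚ))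
    δ≡0 : j ≢ k → δ j k ≡ 0ℚ
    δ≡0 = indicator-no (j Fin.≟ k)
    entries : ∀ {K S d a} → rhs K S d ≡ a → gram N j k ≡ K × gram C j k ≡ S → δ j k ≡ d →
              rhs (gram N j k) (gram C j k) (δ j k) ≡ a
    entries eq (refl , refl) refl = eq
    ring₀ : ∀ T → T * 1ℚ + (1ℚ * 1ℚ + (1ℚ * (- T - 1ℚ) + 0ℚ)) ≡ 0ℚ
    ring₀ = solve-∀ ℚ-ring
    ring₁ : ∀ T → 1ℚ * 1ℚ + (0ℚ * 1ℚ + (0ℚ * (- T - 1ℚ) + 0ℚ)) ≡ 1ℚ
    ring₁ = solve-∀ ℚ-ring
    ring₂ : ∀ T → 0ℚ * 1ℚ + (1ℚ * 1ℚ + (0ℚ * (- T - 1ℚ) + 0ℚ)) ≡ 1ℚ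
    ring₂ = solve-∀ ℚ-ring
    ring₃ : ∀ T → 0ℚ * 1ℚ + (0ℚ * 1ℚ + (0ℚ * (- T - 1ℚ) + 0ℚ)) ≡ 0ℚ
    ring₃ = solve-∀ ℚ-ring
    adjacent : j ~ k → rhs (gram N j k) (gram C j k) (δ j k) ≡ 1ℚ
    adjacent (j≢k , inj₁ (p , p∈j∩k)) =
      entries (ring₁ (fromℕ t)) (uncurry (gram-meeting j≢k) (x∈p∩q⁻ (block j) (block k) p∈j∩k)) (δ≡0 j≢k)
    adjacent (j≢k , inj₂ (i , j∈i , k∈i)) = entries (ring₂ (fromℕ t)) (gram-parallel j≢k j∈i k∈i) (δ≡0 j≢k)
    by-cases : Dec (j ≡ k) → Dec (j ~ k) → adjacency j k ≡ rhs (gram N j k) (gram C j k) (δ j k)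
    by-cases (yes refl) _ = trans (indicator-no (j ~? k) (~-irr refl))
      (sym (entries (ring₀ (fromℕ t)) (N-diagonal j , C-diagonal j) (indicator-yes (j Fin.≟ j) refl)))
    by-cases (no _)   (yes j~k) = trans (indicator-yes (j ~? k) j~k) (sym (adjacent j~k))
    by-cases (no j≢k) (no j≁k)  = trans (indicator-no (j ~? k) j≁k)
      (sym (entries (ring₃ (fromℕ t)) (gram-nonadjacent j≢k j≁k) (δ≡0 j≢k)))

-- Valency, common neighbours and spectrum of the block graph

module BlockGraph {v t : ℕ} .{{_ : NonZero t}} .{{_ : NonZero (t ∸ 1)}} (t<v : t < v) {D : Design v t} (R : Resolution D) where
  open Design D
  open Resolution R
  open Graph (blockGraph D R)
  open ResolvableDesign R
  open GraphCounting (blockGraph D R)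

  V T r : ℚ
  V = fromℕ v
  T = fromℕ t
  r = fromℕ ℓ

  -- Two points exist because 1 ≤ t < v. The block `j₀` through them and its part `i₀` witness that
  -- `b` and `ℓ` are positive, and later anchor the pairs that attain both values of λ.
  two-points : ∃₂ λ (x y : Fin v) → x ≢ y
  two-points = distinct-points (ℕ.≤-<-trans (ℕ.>-nonZero⁻¹ t) t<v)

  p₀ s₀ : Fin v
  p₀ = proj₁ two-points
  s₀ = proj₁ (proj₂ two-points)

  p₀s₀-block : ∃! _≡_ λ j → p₀ ∈ block j × s₀ ∈ block j
  p₀s₀-block = balanced (proj₂ (proj₂ two-points))

  j₀ : Fin b
  j₀ = proj₁ p₀s₀-block

  p₀∈j₀ : p₀ ∈ block j₀
  p₀∈j₀ = proj₁ (proj₁ (proj₂ p₀s₀-block))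

  j₀-part : ∃! _≡_ λ i → ⊤ × j₀ ∈ part i
  j₀-part = IsPartition.exactlyOne blocksPartition j₀

  i₀ : Fin ℓ
  i₀ = proj₁ j₀-part

  j₀∈i₀ : j₀ ∈ part i₀
  j₀∈i₀ = proj₂ (proj₁ (proj₂ j₀-part))

  -- Taken as the size of one part instead of a quotient. `T` times the size of any part is `V`, so
  -- all parts have this size.
  q : ℚ
  q = sum λ j → C j i₀

  T≢0 : T ≢ 0ℚ
  T≢0 = fromℕ≢0 t

  fromℕ[t-1] : fromℕ (t ∸ 1) ≡ T - 1ℚ
  fromℕ[t-1] = fromℕ-pred (fromℕ< (ℕ.>-nonZero⁻¹ t))

  T-1≢0 : T - 1ℚ ≢ 0ℚ
  T-1≢0 eq = fromℕ≢0 (t ∸ 1) (trans fromℕ[t-1] eq)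

  qT≡V : q * T ≡ V
  qT≡V = C-column-* i₀

  C-column : ∀ i → (sum λ j → C j i) ≡ q
  C-column i = *-cancelˡ T≢0 (trans (*-comm T (sum λ j → C j i)) (trans (trans (C-column-* i) (sym qT≡V)) (*-comm q T)))

  r[T-1]≡qT-1 : r * (T - 1ℚ) ≡ q * T - 1ℚ
  r[T-1]≡qT-1 = trans (replication p₀) (cong (_- 1ℚ) (sym qT≡V))

  b≡rq : fromℕ b ≡ r * q
  b≡rq = fromℕ-b C-column

  rq≢0 : r * q ≢ 0ℚ
  rq≢0 rq≡0 = nonempty-b j₀ (fromℕ-injective b 0 (trans b≡rq rq≡0))
    where
    nonempty-b : ∀ {n} → Fin n → n ≢ 0
    nonempty-b () refl

  -- (r - 1) (T - 1) = V - T, which is nonzero by `t<v`.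
  r-1≢0 : r - 1ℚ ≢ 0ℚ
  r-1≢0 r-1≡0 = ℕ.<⇒≢ t<v (fromℕ-injective t v (sym (p-q≡0⇒p≡q (begin
    V - T                ≡⟨ cong (_- T) qT≡V ⟨
    q * T - T            ≡⟨ by-relation (- 1ℚ) (ring T r q) r[T-1]≡qT-1 ⟩
    (r - 1ℚ) * (T - 1ℚ)  ≡⟨ cong (_* (T - 1ℚ)) r-1≡0 ⟩
    0ℚ * (T - 1ℚ)        ≡⟨ *-zeroˡ (T - 1ℚ) ⟩
    0ℚ                   ∎))))
    where
    ring : ∀ T r q → q * T - T - (r - 1ℚ) * (T - 1ℚ) ≡ - 1ℚ * (r * (T - 1ℚ) - (q * T - 1ℚ))
    ring = solve-∀ ℚ-ring

  open IncidenceSpectrum (incidence C-column) (proj₁ (inverse rq≢0)) (proj₁ (inverse r-1≢0))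
    (proj₂ (inverse rq≢0)) (proj₂ (inverse r-1≢0)) r[T-1]≡qT-1 b≡rq
  open IncidenceAlgebra (incidence C-column) using (A; K; S)

  adjacency≗A : ∀ x y → adjacency x y ≡ A x y
  adjacency≗A = adjacency-gram

  -- The quotients of the statement. `F`, `H` and `P` turn out to be r - 1, q - 1 and r, while `G`
  -- and `U` are handled through their products with `T`.
  F G H P U : ℚ
  F = (v ⊖ t) / (t ∸ 1)
  G = (t ⊖ 1) / t
  H = (v ⊖ t) / t
  P = (v ⊖ 1) / (t ∸ 1)
  U = (v ⊖ 1) / t

  GT : G * T ≡ T - 1ℚ
  GT = trans (/-*-cancel (t ⊖ 1) t) (⊖/1 t 1)

  UT : U * T ≡ q * T - 1ℚ
  UT = trans (/-*-cancel (v ⊖ 1) t) (trans (⊖/1 v 1) (cong (_- 1ℚ) (sym qT≡V)))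

  F≡r-1 : F ≡ r - 1ℚ
  F≡r-1 = *-cancelˡ T-1≢0 (begin
    (T - 1ℚ) * F              ≡⟨ *-comm (T - 1ℚ) F ⟩
    F * (T - 1ℚ)              ≡⟨ cong (F *_) fromℕ[t-1] ⟨
    F * fromℕ (t ∸ 1)         ≡⟨ /-*-cancel (v ⊖ t) (t ∸ 1) ⟩
    (v ⊖ t) / 1               ≡⟨ ⊖/1 v t ⟩
    V - T                     ≡⟨ cong (_- T) qT≡V ⟨
    q * T - T                 ≡⟨ by-relation (- 1ℚ) (ring T r q) r[T-1]≡qT-1 ⟩
    (T - 1ℚ) * (r - 1ℚ)       ∎)
    where
    ring : ∀ T r q → q * T - T - (T - 1ℚ) * (r - 1ℚ) ≡ - 1ℚ * (r * (T - 1ℚ) - (q * T - 1ℚ))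
    ring = solve-∀ ℚ-ring

  H≡q-1 : H ≡ q - 1ℚ
  H≡q-1 = *-cancelˡ T≢0 (begin
    T * H          ≡⟨ *-comm T H ⟩
    H * T          ≡⟨ /-*-cancel (v ⊖ t) t ⟩
    (v ⊖ t) / 1    ≡⟨ ⊖/1 v t ⟩
    V - T          ≡⟨ cong (_- T) qT≡V ⟨
    q * T - T      ≡⟨ ring T q ⟩
    T * (q - 1ℚ)   ∎)
    where
    ring : ∀ T q → q * T - T ≡ T * (q - 1ℚ)
    ring = solve-∀ ℚ-ring

  P≡r : P ≡ r
  P≡r = *-cancelˡ T-1≢0 (begin
    (T - 1ℚ) * P          ≡⟨ *-comm (T - 1ℚ) P ⟩
    P * (T - 1ℚ)          ≡⟨ cong (P *_) fromℕ[t-1] ⟨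
    P * fromℕ (t ∸ 1)     ≡⟨ /-*-cancel (v ⊖ 1) (t ∸ 1) ⟩
    (v ⊖ 1) / 1           ≡⟨ ⊖/1 v 1 ⟩
    V - 1ℚ                ≡⟨ replication p₀ ⟨
    r * (T - 1ℚ)          ≡⟨ *-comm r (T - 1ℚ) ⟩
    (T - 1ℚ) * r          ∎)

  -- Both (r - 1) (T - 1) and T (q - 1) equal V - T. In the valency F (T + G), the term F T counts
  -- the blocks meeting a given one and F G those parallel to it.
  [r-1]G≡q-1 : (r - 1ℚ) * G ≡ q - 1ℚ
  [r-1]G≡q-1 = *-cancelˡ T≢0 (by-relations (r - 1ℚ) 1ℚ (ring T r q G) GT r[T-1]≡qT-1)
    where
    ring : ∀ T r q G → T * ((r - 1ℚ) * G) - T * (q - 1ℚ) ≡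
           (r - 1ℚ) * (G * T - (T - 1ℚ)) + 1ℚ * (r * (T - 1ℚ) - (q * T - 1ℚ))
    ring = solve-∀ ℚ-ring

  valency≡ : F * (T + G) ≡ T * r + q - T - 1ℚ
  valency≡ = trans (cong (_* (T + G)) F≡r-1) (by-relation 1ℚ (ring T r q G) [r-1]G≡q-1)
    where
    ring : ∀ T r q G → (r - 1ℚ) * (T + G) - (T * r + q - T - 1ℚ) ≡ 1ℚ * ((r - 1ℚ) * G - (q - 1ℚ))
    ring = solve-∀ ℚ-ring

  θ₁≡ : H - T ≡ q - T - 1ℚ
  θ₁≡ = trans (cong (_- T) H≡q-1) (ring T q)
    where
    ring : ∀ T q → q - 1ℚ - T ≡ q - T - 1ℚ
    ring = solve-∀ ℚ-ring

  θ₂≡ : P - T - fromℕ 2 ≡ r - T - 1ℚ - 1ℚ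
  θ₂≡ = trans (cong (λ h → h - T - (1ℚ + 1ℚ)) P≡r) (ring T r)
    where
    ring : ∀ T r → r - T - (1ℚ + 1ℚ) ≡ r - T - 1ℚ - 1ℚ
    ring = solve-∀ ℚ-ring

  f₃≡ : r * q - r - q * T + 1ℚ ≡ U * (F - T)
  f₃≡ = trans (*-cancelˡ T≢0 (by-relations (- (r - 1ℚ - T)) (- 1ℚ) (ring T r q U) UT r[T-1]≡qT-1))
              (cong (λ h → U * (h - T)) (sym F≡r-1))
    where
    ring : ∀ T r q U → T * (r * q - r - q * T + 1ℚ) - T * (U * (r - 1ℚ - T)) ≡
           (- (r - 1ℚ - T)) * (U * T - (q * T - 1ℚ)) + - 1ℚ * (r * (T - 1ℚ) - (q * T - 1ℚ))
    ring = solve-∀ ℚ-ring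

  degree : ∀ x → fromℕ ∣ neighbours x ∣ ≡ F * (T + G)
  degree x = trans (fromℕ-degree x) (trans (sum-cong-≗ (adjacency≗A x)) (trans (A-1 x) (sym valency≡)))

  -- The rational formula denotes a natural number because it is the degree of `j₀`.
  regular : ∃ λ k → fromℕ k ≡ F * (T + G) × IsRegular k
  regular = ∣ neighbours j₀ ∣ , degree j₀ ,
    λ x → fromℕ-injective ∣ neighbours x ∣ ∣ neighbours j₀ ∣ (trans (degree x) (sym (degree j₀)))

  commonNeighbours-K-S : ∀ {x y κ σ} → x ≢ y → K x y ≡ κ × S x y ≡ σ → fromℕ (commonNeighbours x y) ≡
    κ * (r - T - 1ℚ - 1ℚ + (- T - 1ℚ)) + (σ * (q - T - 1ℚ + (- T - 1ℚ)) + (0ℚ * ((- T - 1ℚ) * (- T - 1ℚ)) + T * (T + (1ℚ + 1ℚ))))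
  commonNeighbours-K-S {x} {y} {κ} {σ} x≢y (Kxy≡κ , Sxy≡σ) = begin
    fromℕ (commonNeighbours x y)
      ≡⟨ fromℕ-commonNeighbours x y ⟩
    (sum λ z → adjacency x z * adjacency z y)
      ≡⟨ sum-cong-≗ (λ z → cong₂ _*_ (adjacency≗A x z) (adjacency≗A z y)) ⟩
    (sum λ z → A x z * A z y)
      ≡⟨ A-A x y ⟩
    K x y * g + (S x y * h + (δ x y * c + T * (T + (1ℚ + 1ℚ))))
      ≡⟨ cong₂ (λ κ w → κ * g + w) Kxy≡κ (cong₂ (λ σ d → σ * h + (d * c + T * (T + (1ℚ + 1ℚ)))) Sxy≡σ (indicator-no (x Fin.≟ y) x≢y)) ⟩
    κ * g + (σ * h + (0ℚ * c + T * (T + (1ℚ + 1ℚ)))) ∎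
    where
    g h c : ℚ
    g = r - T - 1ℚ - 1ℚ + (- T - 1ℚ)
    h = q - T - 1ℚ + (- T - 1ℚ)
    c = (- T - 1ℚ) * (- T - 1ℚ)

  coEdgeRegular : IsCoEdgeRegular (t ℕ.* (t ℕ.+ 2))
  coEdgeRegular x y x≢y x≁y = fromℕ-injective (commonNeighbours x y) (t ℕ.* (t ℕ.+ 2)) (begin
    fromℕ (commonNeighbours x y)    ≡⟨ commonNeighbours-K-S x≢y (gram-nonadjacent x≢y x≁y) ⟩
    _                               ≡⟨ ring (r - T - 1ℚ - 1ℚ + (- T - 1ℚ)) (q - T - 1ℚ + (- T - 1ℚ)) ((- T - 1ℚ) * (- T - 1ℚ)) (T * (T + (1ℚ + 1ℚ))) ⟩
    T * (T + (1ℚ + 1ℚ))             ≡⟨ cong (T *_) (fromℕ-+ t 2) ⟨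
    T * fromℕ (t ℕ.+ 2)             ≡⟨ fromℕ-* t (t ℕ.+ 2) ⟨
    fromℕ (t ℕ.* (t ℕ.+ 2))         ∎)
    where
    ring : ∀ g h c w → 0ℚ * g + (0ℚ * h + (0ℚ * c + w)) ≡ w
    ring = solve-∀ ℚ-ring

  -- These simplify to T² + r - 3 and T² + q - 2. They are left unsimplified as a coefficient of A²
  -- plus the constant T (T + 2).
  λ-meeting λ-parallel : ℚ
  λ-meeting  = r - T - 1ℚ - T - 1ℚ - 1ℚ + T * (T + (1ℚ + 1ℚ))
  λ-parallel = q - T - 1ℚ - T - 1ℚ + T * (T + (1ℚ + 1ℚ))

  commonNeighbours-meeting : ∀ {x y p} → x ≢ y → p ∈ block x → p ∈ block y → fromℕ (commonNeighbours x y) ≡ λ-meeting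
  commonNeighbours-meeting x≢y p∈x p∈y = trans (commonNeighbours-K-S x≢y (gram-meeting x≢y p∈x p∈y)) (ring T r q)
    where
    ring : ∀ T r q → 1ℚ * (r - T - 1ℚ - 1ℚ + (- T - 1ℚ)) + (0ℚ * (q - T - 1ℚ + (- T - 1ℚ)) + (0ℚ * ((- T - 1ℚ) * (- T - 1ℚ)) + T * (T + (1ℚ + 1ℚ)))) ≡
      r - T - 1ℚ - T - 1ℚ - 1ℚ + T * (T + (1ℚ + 1ℚ))
    ring = solve-∀ ℚ-ring

  commonNeighbours-parallel : ∀ {x y i} → x ≢ y → x ∈ part i → y ∈ part i → fromℕ (commonNeighbours x y) ≡ λ-parallel
  commonNeighbours-parallel x≢y x∈i y∈i = trans (commonNeighbours-K-S x≢y (gram-parallel x≢y x∈i y∈i)) (ring T r q)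
    where
    ring : ∀ T r q → 0ℚ * (r - T - 1ℚ - 1ℚ + (- T - 1ℚ)) + (1ℚ * (q - T - 1ℚ + (- T - 1ℚ)) + (0ℚ * ((- T - 1ℚ) * (- T - 1ℚ)) + T * (T + (1ℚ + 1ℚ)))) ≡
      q - T - 1ℚ - T - 1ℚ + T * (T + (1ℚ + 1ℚ))
    ring = solve-∀ ℚ-ring

  -- If the two values coincide then q ≡ r - 1, hence q (T - 1) ≡ (q - 1) T and q ≡ T.
  λ-equal⇒v≡t² : λ-meeting ≡ λ-parallel → v ≡ t ℕ.* t
  λ-equal⇒v≡t² eq = fromℕ-injective v (t ℕ.* t) (begin
    V                  ≡⟨ qT≡V ⟨
    q * T              ≡⟨ cong (_* T) q≡T ⟩
    T * T              ≡⟨ fromℕ-* t t ⟨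
    fromℕ (t ℕ.* t)    ∎)
    where
    ring : ∀ T r q → q - T ≡ (T - 1ℚ) * (r - T - 1ℚ - T - 1ℚ - 1ℚ + T * (T + (1ℚ + 1ℚ)) - (q - T - 1ℚ - T - 1ℚ + T * (T + (1ℚ + 1ℚ)))) +
      - 1ℚ * (r * (T - 1ℚ) - (q * T - 1ℚ))
    ring = solve-∀ ℚ-ring
    q≡T : q ≡ T
    q≡T = by-relations (T - 1ℚ) (- 1ℚ) (ring T r q) eq r[T-1]≡qT-1

  -- Through a point off `j₀` pass a block that also contains `p₀`, hence meets `j₀`, and a block of
  -- the part `i₀`, parallel to `j₀`. Both differ from `j₀`, so both kinds of adjacency occur.
  outside-point : ∃ λ y → ¬ (y ∈ block j₀)
  outside-point = missing-element (block j₀) (subst (_< v) (sym (blockSize j₀)) t<v)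

  y₀ : Fin v
  y₀ = proj₁ outside-point

  meeting-block : ∃! _≡_ λ j → p₀ ∈ block j × y₀ ∈ block j
  meeting-block = balanced λ p₀≡y₀ → proj₂ outside-point (subst (_∈ block j₀) p₀≡y₀ p₀∈j₀)

  parallel-block : ∃! _≡_ λ j → j ∈ part i₀ × y₀ ∈ block j
  parallel-block = IsPartition.exactlyOne (pointsPartition i₀) y₀

  j₁ j₂ : Fin b
  j₁ = proj₁ meeting-block
  j₂ = proj₁ parallel-block

  p₀∈j₁ : p₀ ∈ block j₁
  p₀∈j₁ = proj₁ (proj₁ (proj₂ meeting-block))

  j₂∈i₀ : j₂ ∈ part i₀
  j₂∈i₀ = proj₁ (proj₁ (proj₂ parallel-block))

  j₀≢j₁ : j₀ ≢ j₁
  j₀≢j₁ eq = proj₂ outside-point (subst (λ j → y₀ ∈ block j) (sym eq) (proj₂ (proj₁ (proj₂ meeting-block))))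

  j₀≢j₂ : j₀ ≢ j₂
  j₀≢j₂ eq = proj₂ outside-point (subst (λ j → y₀ ∈ block j) (sym eq) (proj₂ (proj₁ (proj₂ parallel-block))))

  -- For v = t² the design is an affine plane: r = t + 1, q = t, the two values coincide and any two
  -- blocks are adjacent. The hypothesis keeps the two list entries distinct.
  level : v ≢ t ℕ.* t → HasLevel 2
  level v≢t² = a₁ ∷ a₂ ∷ [] , ((a₁≢a₂ All.∷ All.[]) ∷ (All.[] ∷ [])) , refl , λ a → mk⇔ attained occurs
    where
    a₁ a₂ : ℕ
    a₁ = commonNeighbours j₀ j₁
    a₂ = commonNeighbours j₀ j₂

    a₁≡ : fromℕ a₁ ≡ λ-meeting
    a₁≡ = commonNeighbours-meeting j₀≢j₁ p₀∈j₀ p₀∈j₁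

    a₂≡ : fromℕ a₂ ≡ λ-parallel
    a₂≡ = commonNeighbours-parallel j₀≢j₂ j₀∈i₀ j₂∈i₀

    a₁≢a₂ : a₁ ≢ a₂
    a₁≢a₂ eq = v≢t² (λ-equal⇒v≡t² (trans (sym a₁≡) (trans (cong fromℕ eq) a₂≡)))

    attained : ∀ {a} → a ∈ˡ a₁ ∷ a₂ ∷ [] → ∃₂ λ x y → x ~ y × commonNeighbours x y ≡ a
    attained (here refl)         = j₀ , j₁ , (j₀≢j₁ , inj₁ (p₀ , x∈p∩q⁺ (p₀∈j₀ , p₀∈j₁))) , refl
    attained (there (here refl)) = j₀ , j₂ , (j₀≢j₂ , inj₂ (i₀ , j₀∈i₀ , j₂∈i₀)) , refl

    occurs : ∀ {a} → (∃₂ λ x y → x ~ y × commonNeighbours x y ≡ a) → a ∈ˡ a₁ ∷ a₂ ∷ []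
    occurs (x , y , (x≢y , inj₁ (p , p∈x∩y)) , refl) = here (fromℕ-injective (commonNeighbours x y) a₁
      (trans (uncurry (commonNeighbours-meeting x≢y) (x∈p∩q⁻ (block x) (block y) p∈x∩y)) (sym a₁≡)))
    occurs (x , y , (x≢y , inj₂ (i , x∈i , y∈i)) , refl) = there (here (fromℕ-injective (commonNeighbours x y) a₂
      (trans (commonNeighbours-parallel x≢y x∈i y∈i) (sym a₂≡))))

  f₁ f₂ : ℕ
  f₁ = ℓ ∸ 1
  f₂ = v ∸ 1

  fromℕ-f₁ : fromℕ f₁ ≡ r - 1ℚ
  fromℕ-f₁ = fromℕ-pred i₀

  fromℕ-f₂ : fromℕ f₂ ≡ V - 1ℚ
  fromℕ-f₂ = fromℕ-pred p₀

  θ₀ θ₁ θ₂ θ₃ : ℚ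
  θ₀ = T * r + q - T - 1ℚ
  θ₁ = q - T - 1ℚ
  θ₂ = r - T - 1ℚ - 1ℚ
  θ₃ = - T - 1ℚ

  -- The dimension at `θ₃` is the fourth multiplicity alone once the other three values are
  -- different from it. Here T (θ₀ - θ₃) = T² r + V comes from a natural number that is at least v;
  -- the factor T is there to turn the rational `q` into `V`.
  θ₃≢θ₀ : θ₃ ≢ θ₀
  θ₃≢θ₀ eq = ℕ.<⇒≢ (ℕ.<-≤-trans (ℕ.≤-<-trans ℕ.z≤n t<v) (ℕ.m≤n+m v (t ℕ.* (t ℕ.* ℓ)))) (sym (fromℕ-injective _ 0 (begin
    fromℕ (t ℕ.* (t ℕ.* ℓ) ℕ.+ v)    ≡⟨ fromℕ-+ (t ℕ.* (t ℕ.* ℓ)) v ⟩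
    fromℕ (t ℕ.* (t ℕ.* ℓ)) + V      ≡⟨ cong₂ _+_ (trans (fromℕ-* t (t ℕ.* ℓ)) (cong (T *_) (fromℕ-* t ℓ))) (sym qT≡V) ⟩
    T * (T * r) + q * T              ≡⟨ by-relation (- T) (ring T r q) eq ⟩
    0ℚ                               ∎)))
    where
    ring : ∀ T r q → T * (T * r) + q * T - 0ℚ ≡ - T * (- T - 1ℚ - (T * r + q - T - 1ℚ))
    ring = solve-∀ ℚ-ring

  θ₃≢θ₁ : θ₃ ≢ θ₁
  θ₃≢θ₁ eq = rq≢0 (by-relation (- r) (ring T r q) eq)
    where
    ring : ∀ T r q → r * q - 0ℚ ≡ - r * (- T - 1ℚ - (q - T - 1ℚ))
    ring = solve-∀ ℚ-ring

  θ₃≢θ₂ : θ₃ ≢ θ₂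
  θ₃≢θ₂ eq = r-1≢0 (by-relation (- 1ℚ) (ring T r) eq)
    where
    ring : ∀ T r → r - 1ℚ - 0ℚ ≡ - 1ℚ * (- T - 1ℚ - (r - T - 1ℚ - 1ℚ))
    ring = solve-∀ ℚ-ring

  -- f₃ is a natural number because it is the dimension of the eigenspace of θ₃.
  f₃ : ℕ
  f₃ = proj₁ (eigenspace-dimension θ₃)

  fromℕ-f₃ : fromℕ f₃ ≡ r * q - r - q * T + 1ℚ
  fromℕ-f₃ = begin
    fromℕ f₃
      ≡⟨ proj₁ (proj₂ (eigenspace-dimension θ₃)) ⟩
    (sum λ i → indicator (θ₃ ≟ θ i) * multiplicity i)
      ≡⟨ sum₄ (λ i → indicator (θ₃ ≟ θ i) * multiplicity i) ⟩
    indicator (θ₃ ≟ θ₀) * 1ℚ + (indicator (θ₃ ≟ θ₁) * (r - 1ℚ) + (indicator (θ₃ ≟ θ₂) * (q * T - 1ℚ) + (indicator (θ₃ ≟ θ₃) * (r * q - r - q * T + 1ℚ) + 0ℚ)))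
      ≡⟨ cong₂ (λ i j → i * 1ℚ + (j * (r - 1ℚ) + (indicator (θ₃ ≟ θ₂) * (q * T - 1ℚ) + (indicator (θ₃ ≟ θ₃) * (r * q - r - q * T + 1ℚ) + 0ℚ))))
           (indicator-no (θ₃ ≟ θ₀) θ₃≢θ₀) (indicator-no (θ₃ ≟ θ₁) θ₃≢θ₁) ⟩
    0ℚ * 1ℚ + (0ℚ * (r - 1ℚ) + (indicator (θ₃ ≟ θ₂) * (q * T - 1ℚ) + (indicator (θ₃ ≟ θ₃) * (r * q - r - q * T + 1ℚ) + 0ℚ)))
      ≡⟨ cong₂ (λ i j → 0ℚ * 1ℚ + (0ℚ * (r - 1ℚ) + (i * (q * T - 1ℚ) + (j * (r * q - r - q * T + 1ℚ) + 0ℚ))))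
           (indicator-no (θ₃ ≟ θ₂) θ₃≢θ₂) (indicator-yes (θ₃ ≟ θ₃) refl) ⟩
    0ℚ * 1ℚ + (0ℚ * (r - 1ℚ) + (0ℚ * (q * T - 1ℚ) + (1ℚ * (r * q - r - q * T + 1ℚ) + 0ℚ)))
      ≡⟨ ring T r q ⟩
    r * q - r - q * T + 1ℚ ∎
    where
    ring : ∀ T r q → 0ℚ * 1ℚ + (0ℚ * (r - 1ℚ) + (0ℚ * (q * T - 1ℚ) + (1ℚ * (r * q - r - q * T + 1ℚ) + 0ℚ))) ≡ r * q - r - q * T + 1ℚ
    ring = solve-∀ ℚ-ring

  fromℕ-f₂′ : fromℕ f₂ ≡ q * T - 1ℚ
  fromℕ-f₂′ = trans fromℕ-f₂ (cong (_- 1ℚ) (sym qT≡V))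

  Λ : List ℚ
  Λ = spectrum₄ θ₀ θ₁ θ₂ θ₃ f₁ f₂ f₃

  size : length Λ ≡ b
  size = fromℕ-injective (length Λ) b (begin
    fromℕ (length Λ)                               ≡⟨ fromℕ-length θ₀ θ₁ θ₂ θ₃ f₁ f₂ f₃ ⟩
    1ℚ + (fromℕ f₁ + (fromℕ f₂ + fromℕ f₃))        ≡⟨ cong₂ (λ g h → 1ℚ + (g + h)) fromℕ-f₁ (cong₂ _+_ fromℕ-f₂′ fromℕ-f₃) ⟩
    1ℚ + (r - 1ℚ + (q * T - 1ℚ + (r * q - r - q * T + 1ℚ))) ≡⟨ ring T r q ⟩
    r * q                                          ≡⟨ b≡rq ⟨
    fromℕ b                                        ∎)
    where
    ring : ∀ T r q → 1ℚ + (r - 1ℚ + (q * T - 1ℚ + (r * q - r - q * T + 1ℚ))) ≡ r * q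
    ring = solve-∀ ℚ-ring

  occurrences≡dimension : ∀ η → proj₁ (eigenspace-dimension η) ≡ occurrences η Λ
  occurrences≡dimension η = fromℕ-injective (proj₁ (eigenspace-dimension η)) (occurrences η Λ) (begin
    fromℕ (proj₁ (eigenspace-dimension η))
      ≡⟨ proj₁ (proj₂ (eigenspace-dimension η)) ⟩
    (sum λ i → indicator (η ≟ θ i) * multiplicity i)
      ≡⟨ sum₄ (λ i → indicator (η ≟ θ i) * multiplicity i) ⟩
    d₀ * 1ℚ + (d₁ * (r - 1ℚ) + (d₂ * (q * T - 1ℚ) + (d₃ * (r * q - r - q * T + 1ℚ) + 0ℚ)))
      ≡⟨ cong (λ h → d₀ * 1ℚ + (d₁ * (r - 1ℚ) + (d₂ * (q * T - 1ℚ) + h))) (+-identityʳ (d₃ * (r * q - r - q * T + 1ℚ))) ⟩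
    d₀ * 1ℚ + (d₁ * (r - 1ℚ) + (d₂ * (q * T - 1ℚ) + d₃ * (r * q - r - q * T + 1ℚ)))
      ≡⟨ cong₂ (λ g h → d₀ * 1ℚ + (d₁ * g + h)) fromℕ-f₁ (cong₂ (λ g h → d₂ * g + d₃ * h) fromℕ-f₂′ fromℕ-f₃) ⟨
    d₀ * 1ℚ + (d₁ * fromℕ f₁ + (d₂ * fromℕ f₂ + d₃ * fromℕ f₃))
      ≡⟨ fromℕ-occurrences θ₀ θ₁ θ₂ θ₃ f₁ f₂ f₃ η ⟨
    fromℕ (occurrences η Λ) ∎)
    where
    d₀ d₁ d₂ d₃ : ℚ
    d₀ = indicator (η ≟ θ₀)
    d₁ = indicator (η ≟ θ₁)
    d₂ = indicator (η ≟ θ₂)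
    d₃ = indicator (η ≟ θ₃)

  isSpectrum : IsSpectrum adjacency Λ
  isSpectrum = record
    { size         = size
    ; multiplicity = λ η → subst (HasDimension (Eigenspace adjacency η)) (occurrences≡dimension η)
        (eigenspace-cong (λ x y → sym (adjacency≗A x y)) {η} (proj₂ (proj₂ (eigenspace-dimension η))))
    }

  spectrum : ∃ λ f₁ → ∃ λ f₂ → ∃ λ f₃ →
    fromℕ f₁ ≡ F × fromℕ f₂ ≡ V - 1ℚ × fromℕ f₃ ≡ U * (F - T) ×
    IsSpectrum adjacency (spectrum₄ (F * (T + G)) (H - T) (P - T - fromℕ 2) (- T - 1ℚ) f₁ f₂ f₃)
  spectrum = f₁ , f₂ , f₃ , trans fromℕ-f₁ (sym F≡r-1) , fromℕ-f₂ , trans fromℕ-f₃ f₃≡ ,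
    transport (sym valency≡) (sym θ₁≡) (sym θ₂≡) isSpectrum
    where
    transport : ∀ {k k′ η₁ η₁′ η₂ η₂′} → k ≡ k′ → η₁ ≡ η₁′ → η₂ ≡ η₂′ →
                IsSpectrum adjacency (spectrum₄ k η₁ η₂ θ₃ f₁ f₂ f₃) → IsSpectrum adjacency (spectrum₄ k′ η₁′ η₂′ θ₃ f₁ f₂ f₃)
    transport refl refl refl isSpec = isSpec

-- `NonZero (t ∸ 1)` says t ≥ 2, and `⊖` is subtraction in ℤ, so no numerator is truncated. Valency
-- and multiplicities are natural numbers tied to rational formulas, which makes their integrality
-- part of the claim.
theorem4p4 : (v t : ℕ) .{{_ : NonZero t}} .{{_ : NonZero (t ∸ 1)}} → t < v →
    (D : Design v t) (R : Resolution D) →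
    let open Graph (blockGraph D R)
        valency : ℚ
        valency = ((v ⊖ t) / (t ∸ 1)) * (fromℕ t + (t ⊖ 1) / t)
    in
    (∃ λ k → fromℕ k ≡ valency × IsRegular k) ×
    IsCoEdgeRegular (t ℕ.* (t ℕ.+ 2)) ×
    (v ≢ t ℕ.* t → HasLevel 2) ×
    (∃ λ f₁ → ∃ λ f₂ → ∃ λ f₃ →
      fromℕ f₁ ≡ (v ⊖ t) / (t ∸ 1) ×
      fromℕ f₂ ≡ fromℕ v - 1ℚ ×
      fromℕ f₃ ≡ ((v ⊖ 1) / t) * ((v ⊖ t) / (t ∸ 1) - fromℕ t) ×
      IsSpectrum adjacency
        ([ valency ]^ 1 ++
         [ (v ⊖ t) / t - fromℕ t ]^ f₁ ++
         [ (v ⊖ 1) / (t ∸ 1) - fromℕ t - fromℕ 2 ]^ f₂ ++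
         [ - fromℕ t - 1ℚ ]^ f₃))
theorem4p4 v t t<v D R = regular , coEdgeRegular , level , spectrum
  where open BlockGraph t<v R
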